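{- Let $\mathbf{C}$ be a snowflake with $M$ edges. If $M\equiv 0,3 \pmod 4$ then $\mathbf{C}$ is conservative; otherwise (i.e. $M\equiv 1,2\pmod 4$) $\mathbf{C}$ is near-conservative.
   Context: A snowflake is the tree obtained from a disjoint union of stars $S_1,\ldots,S_p$ ($S_i\cong K_{1,n_i}$, $n_i\geq 3$) by identifying one leaf of each star into a single vertex $z$, called the center. A labeling of a graph $G$ is a bijection from $E(G)$ to a set of $|E(G)|$ positive integers. Given an orientation $\overrightarrow{G}$ of $G$ and a labeling $\phi$, the vertex-sum of $u$ is $s(u)=\sum_{\overrightarrow{vu}}\phi(uv)-\sum_{\overrightarrow{uv}}\phi(uv)$ (labels of incoming arcs minus labels of outgoing arcs). For $G$ with $M$ edges, a conservative labeling is a pair (orientation, labeling) with label set $[1,M]$ such that $s(u)=0$ at every vertex $u$ of degree at least $3$; a near-conservative labeling is the same with label set $[1,M-1]\cup\{M+1\}$. Here $[a,b]$ denotes $\{a,a+1,\ldots,b\}$. $G$ is conservative if it admits a conservative labeling, and near-conservative if it is not conservative but admits a near-conservative labeling. -}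

module Defs where

open import Data.Nat using (ℕ; zero; suc; _+_; _∸_; _≤_; _≡ᵇ_)
open import Data.Bool using (Bool; true; false; if_then_else_)
open import Data.Fin using (Fin)
open import Data.List using (List; []; _∷_; _++_; map; length; upTo; lookup)
open import Data.List.Relation.Unary.All using (All)
open import Data.Product using (_×_; _,_; proj₁; proj₂; ∃)
open import Data.Sum using (_⊎_)
open import Data.Integer using (ℤ; +_; -_) renaming (_+_ to _+ℤ_)
open import Relation.Binary.PropositionalEquality using (_≡_; _≢_)
open import Relation.Nullary using (¬_)
open import Function.Definitions using (Injective)

-- A (finite) graph is given by its list of edges; vertices are natural
-- numbers, an edge is an unordered pair {a , b} written (a , b).
-- Edges are indexed by Fin (length G).
Graph : Set
Graph = List (ℕ × ℕ)

Edge : Graph → Set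
Edge G = Fin (length G)

sumFinℕ : ∀ {m} → (Fin m → ℕ) → ℕ
sumFinℕ {zero}  f = 0
sumFinℕ {suc m} f = f Fin.zero + sumFinℕ (λ i → f (Fin.suc i))

sumFinℤ : ∀ {m} → (Fin m → ℤ) → ℤ
sumFinℤ {zero}  f = + 0
sumFinℤ {suc m} f = f Fin.zero +ℤ sumFinℤ (λ i → f (Fin.suc i))

ind : Bool → ℕ
ind true  = 1
ind false = 0

degree : (G : Graph) → ℕ → ℕ
degree G u = sumFinℕ {length G} λ e →
  ind (proj₁ (lookup G e) ≡ᵇ u) + ind (proj₂ (lookup G e) ≡ᵇ u)

-- An orientation: o e = true orients edge (a , b) as the arc a → b,
-- o e = false as the arc b → a.
Orientation : Graph → Set
Orientation G = Edge G → Bool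

tail : (G : Graph) → Orientation G → Edge G → ℕ
tail G o e = if o e then proj₁ (lookup G e) else proj₂ (lookup G e)

head : (G : Graph) → Orientation G → Edge G → ℕ
head G o e = if o e then proj₂ (lookup G e) else proj₁ (lookup G e)

vertexSum : (G : Graph) → Orientation G → (Edge G → ℕ) → ℕ → ℤ
vertexSum G o φ u = sumFinℤ {length G} λ e →
  (if head G o e ≡ᵇ u then + φ e else + 0) +ℤ
  (if tail G o e ≡ᵇ u then - (+ φ e) else + 0)

IsLabeling : (G : Graph) → (ℕ → Set) → (Edge G → ℕ) → Set
IsLabeling G L φ =
  Injective _≡_ _≡_ φ × (∀ e → L (φ e)) × (∀ x → L x → ∃ λ e → φ e ≡ x)

Balanced : (G : Graph) → Orientation G → (Edge G → ℕ) → Set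
Balanced G o φ = ∀ u → 3 ≤ degree G u → vertexSum G o φ u ≡ + 0

LabelsCons : ℕ → ℕ → Set
LabelsCons M x = 1 ≤ x × x ≤ M

LabelsNear : ℕ → ℕ → Set
LabelsNear M x = (1 ≤ x × x ≤ M ∸ 1) ⊎ x ≡ suc M

AdmitsLabeling : Graph → (ℕ → Set) → Set
AdmitsLabeling G L = ∃ λ (o : Orientation G) → ∃ λ (φ : Edge G → ℕ) →
  IsLabeling G L φ × Balanced G o φ

Conservative : Graph → Set
Conservative G = AdmitsLabeling G (LabelsCons (length G))

NearConservative : Graph → Set
NearConservative G =
  ¬ Conservative G × AdmitsLabeling G (LabelsNear (length G))

-- Snowflake: center z = vertex 0.  Star S_i ≅ K_{1,n_i} has center c and
-- leaves z, c+1, …, c+n_i-1 (one leaf identified with z).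
star : ℕ → ℕ → Graph
star c n = (0 , c) ∷ map (λ k → (c , c + suc k)) (upTo (n ∸ 1))

snowflakeFrom : ℕ → List ℕ → Graph
snowflakeFrom c []       = []
snowflakeFrom c (n ∷ ns) = star c n ++ snowflakeFrom (c + n) ns

snowflake : List ℕ → Graph
snowflake ns = snowflakeFrom 1 ns

ValidSnowflake : List ℕ → Set
ValidSnowflake ns = ns ≢ [] × All (3 ≤_) ns

{-# OPTIONS --safe #-}
module Submission where

-- If all stars are balanced then each of them has an even label sum, which
-- excludes conservative labelings for M ≡ 1, 2 (mod 4) and near-conservative
-- ones for M ≡ 0, 3.  So it is enough to find a labeling of either kind.
-- Four more leaves can always be added to a star (two pairs of new labels with
-- difference 2 and opposite signs), so all stars may be taken of size 3, 4, 5 or 6.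
-- Stars of size 4 and 6 are labeled by almost consecutive numbers.  The q stars of
-- odd size come from a (hooked) Skolem sequence, i.e. triples s, y, y + s with
-- s = 1, …, q.  To enlarge stars to size 5, their pairs (y, y + s) are exchanged with those
-- of stars at distance 2 (or 1), and the resulting defects are compensated by
-- new labels.  At the center the small labels s cancel by a suitable choice of signs; the
-- parity is corrected by using for one star an even label y or y + s instead of s.

open import Defs
open import Data.Bool using (Bool; true; false; if_then_else_)
open import Data.Fin using (Fin) renaming (zero to fzero; suc to fsuc)
open import Data.Integer as ℤ using (ℤ; +_; -_; ∣_∣; 0ℤ; -[1+_])
import Data.Integer.Properties as ℤ
import Data.Integer.Tactic.RingSolver as ℤRing
open import Data.List as List
  using (List; []; _∷_; _++_; map; foldr; length; concat; concatMap; replicate; tabulate; applyUpTo)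
open import Data.List.Membership.Propositional using (_∈_)
open import Data.List.Membership.Propositional.Properties
  using (∈-map⁻; ∈-∃++; ∈-tabulate⁺; ∈-tabulate⁻)
open import Data.List.Membership.Propositional.Properties.WithK using (unique∧set⇒bag)
open import Data.List.Properties
  using (map-++; map-∘; map-cong; map-replicate; length-map; length-++; length-replicate; ++-assoc;
         ++-identityʳ; concatMap-++; ∷-injective)
open import Data.List.Relation.Binary.BagAndSetEquality using (∼bag⇒↭)
open import Data.List.Relation.Binary.Permutation.Propositional
open import Data.List.Relation.Binary.Permutation.Propositional.Properties
  using (shift; shifts; ++⁺ˡ; ++⁺ʳ; ++⁺; ++-comm; map⁺; ↭-length; ∷↭∷ʳ; ↭-map-inv; All-resp-↭; ∈-resp-↭)
import Data.List.Relation.Binary.Permutation.Setoid.Properties as Permutationₛ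
open import Data.List.Relation.Binary.Pointwise using (Pointwise; []; _∷_; Pointwise-length)
open import Data.List.Relation.Unary.All as All using (All; []; _∷_)
import Data.List.Relation.Unary.All.Properties as All
open import Data.List.Relation.Unary.AllPairs using ([]; _∷_)
open import Data.List.Relation.Unary.Any using (here; there)
open import Data.List.Relation.Unary.Unique.Propositional using (Unique)
open import Data.List.Relation.Unary.Unique.Propositional.Properties using (tabulate⁺)
open import Data.Nat as ℕ
  using (ℕ; zero; suc; _+_; _*_; _≤_; _<_; z≤n; s≤s; ∣_-_∣; _≡ᵇ_; _%_; _/_)
open import Data.Nat.DivMod using (_divMod_; result; m≡m%n+[m/n]*n)
open import Data.Nat.ListAction using (sum)
open import Data.Nat.ListAction.Properties using (sum-++; sum-↭)
open import Data.Nat.Properties as ℕ using (+-comm; +-assoc)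
import Data.Nat.Tactic.RingSolver as ℕRing
open import Data.Product using (∃; ∃₂; _×_; _,_; proj₁; proj₂; uncurry)
open import Data.Sum using (_⊎_; inj₁; inj₂)
open import Data.Unit using (⊤; tt)
open import Function using (_∘_; mk⇔)
open import Relation.Binary.Definitions using (Tri; tri<; tri≈; tri>)
open import Relation.Binary.PropositionalEquality as ≡
  using (_≡_; _≢_; refl; sym; cong; cong₂; subst; module ≡-Reasoning)
open import Relation.Nullary using (¬_; Dec; yes; no; contradiction)

-- Labels are handed out in the order odd stars, even stars, repairs. The triples of the q odd stars
-- fill the bottom of the label set; the even stars follow; only then come the pairs that turn
-- defective triples into stars of size 5. Repairs never change a head, but they must work from
-- whichever state the even stars leave behind. The center is the main obstacle; it is constrained
-- only by three or more stars. A positive even number of even stars can contribute the head sum -1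
-- or -2, which small labels cancel easily. An odd number contributes about N, the frontier left by
-- the odd stars, and N is 3q or 3q - 1. The small labels, of sum q(q + 1)/2, would have to cancel 1
-- + N, but q(q + 1)/2 and N always have the same parity, so one star has to show an even member of
-- its pair in place of an odd small label. For few odd stars the small labels leave too little
-- room, which accounts for the cases treated by hand.

private variable
  A : Set

-- Explicit permutations of lists

pickAt : ℕ → A → List A → A × List A
pickAt zero    x xs       = x , xs
pickAt (suc i) x []       = x , []
pickAt (suc i) x (y ∷ ys) = proj₁ (pickAt i y ys) , x ∷ proj₂ (pickAt i y ys)

pickAt-↭ : ∀ i (x : A) xs → x ∷ xs ↭ proj₁ (pickAt i x xs) ∷ proj₂ (pickAt i x xs)
pickAt-↭ zero    x xs       = ↭-refl
pickAt-↭ (suc i) x []       = ↭-refl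
pickAt-↭ (suc i) x (y ∷ ys) = ↭-trans (prep x (pickAt-↭ i y ys)) (swap x _ ↭-refl)

-- Each index refers to the elements that are still left; permutations of
-- explicit lists are given below by such a list of indices.
select : List ℕ → List A → List A
select []       xs       = xs
select (i ∷ is) []       = []
select (i ∷ is) (x ∷ xs) = proj₁ (pickAt i x xs) ∷ select is (proj₂ (pickAt i x xs))

select-↭ : ∀ is (xs : List A) → xs ↭ select is xs
select-↭ []       xs       = ↭-refl
select-↭ (i ∷ is) []       = ↭-refl
select-↭ (i ∷ is) (x ∷ xs) = ↭-trans (pickAt-↭ i x xs) (prep _ (select-↭ is _))

concat-↭ : {xss yss : List (List A)} → xss ↭ yss → concat xss ↭ concat yss
concat-↭ refl = ↭-refl
concat-↭ (prep xs p) = ++⁺ˡ xs (concat-↭ p)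
concat-↭ {yss = _ ∷ _ ∷ yss} (swap xs ys p) = begin
  xs ++ ys ++ _     ≡⟨ ++-assoc xs ys _ ⟨
  (xs ++ ys) ++ _   ↭⟨ ++⁺ (++-comm xs ys) (concat-↭ p) ⟩
  (ys ++ xs) ++ _   ≡⟨ ++-assoc ys xs _ ⟩
  ys ++ xs ++ _     ∎
  where open PermutationReasoning
concat-↭ (trans p q) = ↭-trans (concat-↭ p) (concat-↭ q)

-- Signed sums and stars as blocks of signed labels

total : List ℤ → ℤ
total = foldr ℤ._+_ 0ℤ

total-↭ : ∀ {xs ys} → xs ↭ ys → total xs ≡ total ys
total-↭ refl = refl
total-↭ (prep x p) = cong (ℤ._+_ x) (total-↭ p)
total-↭ (swap x y p) rewrite total-↭ p = exchange x y _
  where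
  exchange : ∀ a b c → a ℤ.+ (b ℤ.+ c) ≡ b ℤ.+ (a ℤ.+ c)
  exchange = ℤRing.solve-∀
total-↭ (trans p q) = ≡.trans (total-↭ p) (total-↭ q)

total-++ : ∀ xs ys → total (xs ++ ys) ≡ total xs ℤ.+ total ys
total-++ []       ys = sym (ℤ.+-identityˡ _)
total-++ (x ∷ xs) ys rewrite total-++ xs ys = sym (ℤ.+-assoc x _ _)

total-neg : ∀ xs → total (map -_ xs) ≡ - total xs
total-neg []       = refl
total-neg (x ∷ xs) rewrite total-neg xs = sym (ℤ.neg-distrib-+ x _)

map-∣-∣-neg : ∀ xs → map ∣_∣ (map -_ xs) ≡ map ∣_∣ xs
map-∣-∣-neg xs = ≡.trans (sym (map-∘ xs)) (map-cong ℤ.∣-i∣≡∣i∣ xs)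

∣i∣≡∣j∣⇒i≡±j : ∀ i j → ∣ i ∣ ≡ ∣ j ∣ → i ≡ j ⊎ i ≡ - j
∣i∣≡∣j∣⇒i≡±j (+ m)    (+ n)        refl = inj₁ refl
∣i∣≡∣j∣⇒i≡±j (+ _)    -[1+ n ]     refl = inj₂ refl
∣i∣≡∣j∣⇒i≡±j -[1+ m ] (+ _)        refl = inj₂ refl
∣i∣≡∣j∣⇒i≡±j -[1+ m ] -[1+ n ]     refl = inj₁ refl

-- A star is recorded by the signed label of its edge at the center of the
-- snowflake (the head) and the signed labels of its leaf edges.
Block : Set
Block = ℤ × List ℤ

entries : Block → List ℤ
entries (h , t) = h ∷ t

blockLabels : Block → List ℕ
blockLabels b = map ∣_∣ (entries b)

-- A star is demanded as a pair (size , defect). The defect matters only up to sign, because all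
-- entries of a star may be negated together.
Spec : Set
Spec = List (ℕ × ℕ)

Fits : ℕ × ℕ → Block → Set
Fits (n , a) b = length (entries b) ≡ n × ∣ total (entries b) ∣ ≡ a

-- The absolute values of the block sums are prescribed by the specification,
-- the sum of the heads is V and the labels used are those in L.
record Conf (L : List ℕ) (V : ℤ) (sp : Spec) : Set where
  constructor conf
  field
    blocks : List Block
    fits   : Pointwise Fits sp blocks
    heads  : total (map proj₁ blocks) ≡ V
    labels : concatMap blockLabels blocks ↭ L

relabel : ∀ {L L′ V sp} → L ↭ L′ → Conf L V sp → Conf L′ V sp
relabel p (conf bs fs hs ls) = conf bs fs hs (↭-trans ls p)

Pointwise-↭ : ∀ {A B : Set} {R : A → B → Set} {xs xs′ ys} → xs ↭ xs′ → Pointwise R xs ys →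
  ∃ λ ys′ → ys ↭ ys′ × Pointwise R xs′ ys′
Pointwise-↭ refl rs = _ , ↭-refl , rs
Pointwise-↭ (prep x p) (r ∷ rs) with _ , p′ , rs′ ← Pointwise-↭ p rs = _ , prep _ p′ , r ∷ rs′
Pointwise-↭ (swap x y p) (r ∷ r′ ∷ rs) with _ , p′ , rs′ ← Pointwise-↭ p rs = _ , swap _ _ p′ , r′ ∷ r ∷ rs′
Pointwise-↭ (trans p q) rs with _ , p′ , rs′ ← Pointwise-↭ p rs
                           with _ , q′ , rs″ ← Pointwise-↭ q rs′ = _ , ↭-trans p′ q′ , rs″

reorder : ∀ {L V sp sp′} → sp ↭ sp′ → Conf L V sp → Conf L V sp′
reorder p (conf bs fs hs ls) with bs′ , q , fs′ ← Pointwise-↭ p fs =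
  conf bs′ fs′ (≡.trans (total-↭ (map⁺ proj₁ (↭-sym q))) hs)
    (↭-trans (concat-↭ (map⁺ blockLabels (↭-sym q))) ls)

empty : Conf [] 0ℤ []
empty = conf [] [] refl ↭-refl

-- Any entry can be moved to the front, and negating all entries changes its sign.
focus : ∀ xs h → ∣ h ∣ ∈ map ∣_∣ xs → ∃ λ t →
  map ∣_∣ (h ∷ t) ↭ map ∣_∣ xs × ∣ total (h ∷ t) ∣ ≡ ∣ total xs ∣
focus xs h h∈ with z , z∈ , eq ← ∈-map⁻ ∣_∣ h∈
              with us , vs , refl ← ∈-∃++ z∈
              with ∣i∣≡∣j∣⇒i≡±j h z eq
... | inj₁ refl = us ++ vs , map⁺ ∣_∣ (↭-sym (shift z us vs)) , cong ∣_∣ (total-↭ (↭-sym (shift z us vs)))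
... | inj₂ refl = map -_ (us ++ vs) ,
  ↭-trans (↭-reflexive (map-∣-∣-neg (z ∷ us ++ vs))) (map⁺ ∣_∣ (↭-sym (shift z us vs))) ,
  ≡.trans (cong ∣_∣ (total-neg (z ∷ us ++ vs)))
    (≡.trans (ℤ.∣-i∣≡∣i∣ (total (z ∷ us ++ vs))) (cong ∣_∣ (total-↭ (↭-sym (shift z us vs)))))

-- The sign of `h` need not agree with its sign in `xs`: `focus` negates the whole star if
-- necessary. So the balance of a star and its contribution to the center are chosen independently.
add : ∀ {L V a sp} xs h → ∣ total xs ∣ ≡ a → ∣ h ∣ ∈ map ∣_∣ xs → Conf L V sp →
  Conf (map ∣_∣ xs ++ L) (h ℤ.+ V) ((length xs , a) ∷ sp)
add xs h refl h∈ (conf bs fs hs ls) with t , p , s ← focus xs h h∈ =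
  conf ((h , t) ∷ bs)
    ((≡.trans (sym (length-map ∣_∣ (h ∷ t))) (≡.trans (↭-length p) (length-map ∣_∣ xs)) , s) ∷ fs)
    (cong (ℤ._+_ h) hs) (++⁺ p ls)

cancel : ∀ i xs → ∣ i ∣ ≡ ∣ total xs ∣ → ∃ λ ys →
  length ys ≡ length xs × map ∣_∣ ys ≡ map ∣_∣ xs × i ℤ.+ total ys ≡ 0ℤ
cancel i xs eq with ∣i∣≡∣j∣⇒i≡±j i (total xs) eq
... | inj₁ refl = map -_ xs , length-map -_ xs , map-∣-∣-neg xs ,
                  ≡.trans (cong (ℤ._+_ (total xs)) (total-neg xs)) (ℤ.+-inverseʳ (total xs))
... | inj₂ refl = xs , refl , refl , ℤ.+-inverseˡ (total xs)

-- The new entries are negated or not so as to cancel the defect; the old entries stay, hence the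
-- head and `V` are unaffected.
attach : ∀ {L V n a sp} xs → ∣ total xs ∣ ≡ a → Conf L V ((n , a) ∷ sp) →
  Conf (map ∣_∣ xs ++ L) V ((length xs + n , 0) ∷ sp)
attach {n = n} xs refl (conf ((h , t) ∷ bs) ((len , s) ∷ fs) hs ls)
  with ys , leny , absy , zero-sum ← cancel (total (h ∷ t)) xs s =
  conf ((h , t ++ ys) ∷ bs)
    ((lengths , cong ∣_∣ (≡.trans (total-++ (h ∷ t) ys) zero-sum)) ∷ fs) hs
    (↭-trans new-labels (++⁺ˡ (map ∣_∣ xs) ls))
  where
  rest : List ℕ
  rest = concatMap blockLabels bs
  lengths : length (h ∷ t ++ ys) ≡ length xs + n
  lengths rewrite sym len | sym leny = ≡.trans (length-++ (h ∷ t)) (+-comm (length (h ∷ t)) _)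
  new-labels : map ∣_∣ (h ∷ t ++ ys) ++ rest ↭ map ∣_∣ xs ++ map ∣_∣ (h ∷ t) ++ rest
  new-labels = begin
    map ∣_∣ ((h ∷ t) ++ ys) ++ rest             ≡⟨ cong (_++ rest) (map-++ ∣_∣ (h ∷ t) ys) ⟩
    (map ∣_∣ (h ∷ t) ++ map ∣_∣ ys) ++ rest     ↭⟨ ++⁺ʳ rest (++-comm (map ∣_∣ (h ∷ t)) _) ⟩
    (map ∣_∣ ys ++ map ∣_∣ (h ∷ t)) ++ rest     ≡⟨ ++-assoc (map ∣_∣ ys) _ rest ⟩
    map ∣_∣ ys ++ map ∣_∣ (h ∷ t) ++ rest       ≡⟨ cong (_++ map ∣_∣ (h ∷ t) ++ rest) absy ⟩
    map ∣_∣ xs ++ map ∣_∣ (h ∷ t) ++ rest       ∎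
    where open PermutationReasoning

-- Label sets and the enlargement of stars

descend : ℕ → List ℕ
descend zero    = []
descend (suc n) = suc n ∷ descend n

-- The label sets [1 , n] and [1 , n] ∪ {n + 2}; the latter is the label set of a
-- near-conservative labeling with M = n + 1.
data State : Set where
  full gap : ℕ → State

frontier : State → ℕ
frontier (full n) = n
frontier (gap n)  = n

used : State → List ℕ
used (full n) = descend n
used (gap n)  = suc (suc n) ∷ descend n

-- The final state may stay open: its kind is forced by the parity of the label sum, and `conclude`
-- reads it off.
Solvable : ℤ → Spec → Set
Solvable V sp = ∃ λ st → Conf (used st) V sp

resolve : ∀ {V sp sp′} → sp ↭ sp′ → Solvable V sp → Solvable V sp′
resolve p (st , c) = st , reorder p c

toggle : State → State
toggle (full n) = gap (suc n)
toggle (gap n)  = full (3 + n)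

-- The pair consists of the labels frontier + 1 and frontier + 3 in either state.
fix-two : ∀ {V n sp} st → Conf (used st) V ((n , 2) ∷ sp) → Conf (used (toggle st)) V ((2 + n , 0) ∷ sp)
fix-two st c = relabel (pair-↭ st) (attach pair (cong ∣_∣ (difference (+ frontier st))) c)
  where
  pair : List ℤ
  pair = + (3 + frontier st) ∷ - + (1 + frontier st) ∷ []
  difference : ∀ x → (+ 3 ℤ.+ x) ℤ.+ (- (+ 1 ℤ.+ x) ℤ.+ + 0) ≡ + 2
  difference = ℤRing.solve-∀
  pair-↭ : ∀ st → 3 + frontier st ∷ 1 + frontier st ∷ used st ↭ used (toggle st)
  pair-↭ (full n) = ↭-refl
  pair-↭ (gap n)  = select-↭ (0 ∷ 1 ∷ []) _

fix-two-solvable : ∀ {V n sp} → Solvable V ((n , 2) ∷ sp) → Solvable V ((2 + n , 0) ∷ sp)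
fix-two-solvable (st , c) = toggle st , fix-two st c

grow-four : ∀ {V n sp} → Solvable V ((n , 0) ∷ sp) → Solvable V ((4 + n , 0) ∷ sp)
grow-four (full m , c) = full (4 + m) , relabel (select-↭ (3 ∷ 2 ∷ 1 ∷ 0 ∷ []) _)
  (attach (+ (1 + m) ∷ - + (2 + m) ∷ - + (3 + m) ∷ + (4 + m) ∷ []) (cong ∣_∣ (zero-sum (+ m))) c)
  where
  zero-sum : ∀ x → (+ 1 ℤ.+ x) ℤ.+ (- (+ 2 ℤ.+ x) ℤ.+ (- (+ 3 ℤ.+ x) ℤ.+ ((+ 4 ℤ.+ x) ℤ.+ + 0))) ≡ + 0
  zero-sum = ℤRing.solve-∀
-- The label `2 + m` is taken, so the pairs of difference 2 are `1 + m`, `3 + m` and `4 + m`,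
-- `6 + m`; the gap moves up by four.
grow-four (gap m , c) = gap (4 + m) , relabel (select-↭ (3 ∷ 2 ∷ 1 ∷ 1 ∷ 0 ∷ []) _)
  (attach (+ (1 + m) ∷ - + (3 + m) ∷ - + (4 + m) ∷ + (6 + m) ∷ []) (cong ∣_∣ (zero-sum (+ m))) c)
  where
  zero-sum : ∀ x → (+ 1 ℤ.+ x) ℤ.+ (- (+ 3 ℤ.+ x) ℤ.+ (- (+ 4 ℤ.+ x) ℤ.+ ((+ 6 ℤ.+ x) ℤ.+ + 0))) ≡ + 0
  zero-sum = ℤRing.solve-∀

-- Stars of even size

zeros : List ℕ → Spec
zeros = map (_, 0)

EvenSize : ℕ → Set
EvenSize n = n ≡ 4 ⊎ n ≡ 6

-- The membership fields list the labels that serve as heads. `2 + frontier st` is avoided since a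
-- gap state has used it. `before` and `suc before`, set against the first label of the following
-- star, give the head sums -2 and ±1.
record EvenStar (st : State) (n : ℕ) : Set where
  field
    values   : List ℤ
    next     : State
    size     : length values ≡ n
    balanced : total values ≡ 0ℤ
    consumes : map ∣_∣ values ++ used st ↭ used next
    first∈   : 1 + frontier st ∈ map ∣_∣ values
    third∈   : 3 + frontier st ∈ map ∣_∣ values
    fourth∈  : 4 + frontier st ∈ map ∣_∣ values
    before   : ℕ
    before-≡ : frontier next ≡ suc before
    before∈  : before ∈ map ∣_∣ values
    last∈    : suc before ∈ map ∣_∣ values

evenStar : ∀ st {n} → EvenSize n → EvenStar st n
evenStar (full m) (inj₁ refl) = record
  { values   = + (1 + m) ∷ - + (2 + m) ∷ - + (3 + m) ∷ + (4 + m) ∷ []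
  ; next     = full (4 + m)
  ; size     = refl
  ; balanced = zero-sum (+ m)
  ; consumes = select-↭ (3 ∷ 2 ∷ 1 ∷ 0 ∷ []) _
  ; first∈   = here refl
  ; third∈   = there (there (here refl))
  ; fourth∈  = there (there (there (here refl)))
  ; before   = 3 + m
  ; before-≡ = refl
  ; before∈  = there (there (here refl))
  ; last∈    = there (there (there (here refl)))
  }
  where
  zero-sum : ∀ x → (+ 1 ℤ.+ x) ℤ.+ (- (+ 2 ℤ.+ x) ℤ.+ (- (+ 3 ℤ.+ x) ℤ.+ ((+ 4 ℤ.+ x) ℤ.+ + 0))) ≡ + 0
  zero-sum = ℤRing.solve-∀
evenStar (gap m) (inj₁ refl) = record
  { values   = + (1 + m) ∷ - + (3 + m) ∷ - + (4 + m) ∷ + (6 + m) ∷ []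
  ; next     = gap (4 + m)
  ; size     = refl
  ; balanced = zero-sum (+ m)
  ; consumes = select-↭ (3 ∷ 2 ∷ 1 ∷ 1 ∷ 0 ∷ []) _
  ; first∈   = here refl
  ; third∈   = there (here refl)
  ; fourth∈  = there (there (here refl))
  ; before   = 3 + m
  ; before-≡ = refl
  ; before∈  = there (here refl)
  ; last∈    = there (there (here refl))
  }
  where
  zero-sum : ∀ x → (+ 1 ℤ.+ x) ℤ.+ (- (+ 3 ℤ.+ x) ℤ.+ (- (+ 4 ℤ.+ x) ℤ.+ ((+ 6 ℤ.+ x) ℤ.+ + 0))) ≡ + 0
  zero-sum = ℤRing.solve-∀
evenStar (full m) (inj₂ refl) = record
  -- Six consecutive numbers have an odd sum, so one number is skipped and the state toggles.
  { values   = + (1 + m) ∷ - + (2 + m) ∷ + (3 + m) ∷ - + (4 + m) ∷ - + (5 + m) ∷ + (7 + m) ∷ []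
  ; next     = gap (5 + m)
  ; size     = refl
  ; balanced = zero-sum (+ m)
  ; consumes = select-↭ (5 ∷ 4 ∷ 3 ∷ 2 ∷ 1 ∷ 0 ∷ []) _
  ; first∈   = here refl
  ; third∈   = there (there (here refl))
  ; fourth∈  = there (there (there (here refl)))
  ; before   = 4 + m
  ; before-≡ = refl
  ; before∈  = there (there (there (here refl)))
  ; last∈    = there (there (there (there (here refl))))
  }
  where
  zero-sum : ∀ x → (+ 1 ℤ.+ x) ℤ.+ (- (+ 2 ℤ.+ x) ℤ.+ ((+ 3 ℤ.+ x) ℤ.+ (- (+ 4 ℤ.+ x) ℤ.+
    (- (+ 5 ℤ.+ x) ℤ.+ ((+ 7 ℤ.+ x) ℤ.+ + 0))))) ≡ + 0
  zero-sum = ℤRing.solve-∀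
evenStar (gap m) (inj₂ refl) = record
  { values   = - + (1 + m) ∷ + (3 + m) ∷ + (4 + m) ∷ - + (5 + m) ∷ + (6 + m) ∷ - + (7 + m) ∷ []
  ; next     = full (7 + m)
  ; size     = refl
  ; balanced = zero-sum (+ m)
  ; consumes = select-↭ (5 ∷ 4 ∷ 3 ∷ 2 ∷ 1 ∷ 1 ∷ 0 ∷ []) _
  ; first∈   = here refl
  ; third∈   = there (here refl)
  ; fourth∈  = there (there (here refl))
  ; before   = 6 + m
  ; before-≡ = refl
  ; before∈  = there (there (there (there (here refl))))
  ; last∈    = there (there (there (there (there (here refl)))))
  }
  where
  zero-sum : ∀ x → - (+ 1 ℤ.+ x) ℤ.+ ((+ 3 ℤ.+ x) ℤ.+ ((+ 4 ℤ.+ x) ℤ.+ (- (+ 5 ℤ.+ x) ℤ.+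
    ((+ 6 ℤ.+ x) ℤ.+ (- (+ 7 ℤ.+ x) ℤ.+ + 0))))) ≡ + 0
  zero-sum = ℤRing.solve-∀

-- A transition is uniform in the configuration it starts from, so runs of even stars compose before
-- the odd part is known.
record Adds (st st′ : State) (es : List ℕ) (U : ℤ) : Set where
  constructor adds
  field run : ∀ {W sp} → Conf (used st) W sp → Conf (used st′) (U ℤ.+ W) (zeros es ++ sp)

adds-≡ : ∀ {st st′ es U U′} → U ≡ U′ → Adds st st′ es U → Adds st st′ es U′
adds-≡ refl ad = ad

adds-++ : ∀ {st₀ st₁ st₂ U₁ U₂} es₁ es₂ → Adds st₀ st₁ es₁ U₁ → Adds st₁ st₂ es₂ U₂ →
  Adds st₀ st₂ (es₁ ++ es₂) (U₁ ℤ.+ U₂)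
adds-++ {U₁ = U₁} {U₂} es₁ es₂ (adds f) (adds g) = adds λ {W} {sp} c →
  subst (λ V → Conf _ V _) (regroup U₁ U₂ W) (reorder (order sp) (g (f c)))
  where
  regroup : ∀ a b c → b ℤ.+ (a ℤ.+ c) ≡ (a ℤ.+ b) ℤ.+ c
  regroup = ℤRing.solve-∀
  order : ∀ sp → zeros es₂ ++ zeros es₁ ++ sp ↭ zeros (es₁ ++ es₂) ++ sp
  order sp = begin
    zeros es₂ ++ zeros es₁ ++ sp   ≡⟨ ++-assoc (zeros es₂) (zeros es₁) sp ⟨
    (zeros es₂ ++ zeros es₁) ++ sp ↭⟨ ++⁺ʳ sp (++-comm (zeros es₂) (zeros es₁)) ⟩
    (zeros es₁ ++ zeros es₂) ++ sp ≡⟨ cong (_++ sp) (map-++ (_, 0) es₁ es₂) ⟨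
    zeros (es₁ ++ es₂) ++ sp       ∎
    where open PermutationReasoning

module _ {st : State} {n : ℕ} (E : EvenStar st n) where
  open EvenStar E

  adds-star : ∀ h → ∣ h ∣ ∈ map ∣_∣ values → Adds st next (n ∷ []) h
  adds-star h h∈ = adds λ {W} {sp} c →
    subst (λ k → Conf _ (h ℤ.+ W) ((k , 0) ∷ sp)) size
      (relabel consumes (add values h (cong ∣_∣ balanced) h∈ c))

module _ {st : State} {a b : ℕ} (E : EvenStar st a) (F : EvenStar (EvenStar.next E) b) where
  private
    module E = EvenStar E
    module F = EvenStar F

    adds-two : ∀ g h {U} → ∣ g ∣ ∈ map ∣_∣ E.values → ∣ h ∣ ∈ map ∣_∣ F.values → g ℤ.+ h ≡ U →
      Adds st F.next (a ∷ b ∷ []) U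
    adds-two g h g∈ h∈ refl = adds-++ (a ∷ []) (b ∷ []) (adds-star E g g∈) (adds-star F h h∈)

    start∈ : 2 + E.before ∈ map ∣_∣ F.values
    start∈ = subst (λ k → suc k ∈ _) E.before-≡ F.first∈

  adds-minus1 : Adds st F.next (a ∷ b ∷ []) (- + 1)
  adds-minus1 = adds-two (+ suc E.before) (- + (2 + E.before)) E.last∈ start∈ (eq (+ E.before))
    where
    eq : ∀ x → (+ 1 ℤ.+ x) ℤ.+ - (+ 2 ℤ.+ x) ≡ - + 1
    eq = ℤRing.solve-∀

  adds-plus1 : Adds st F.next (a ∷ b ∷ []) (+ 1)
  adds-plus1 = adds-two (- + suc E.before) (+ (2 + E.before)) E.last∈ start∈ (eq (+ E.before))
    where
    eq : ∀ x → - (+ 1 ℤ.+ x) ℤ.+ (+ 2 ℤ.+ x) ≡ + 1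
    eq = ℤRing.solve-∀

  adds-minus2 : Adds st F.next (a ∷ b ∷ []) (- + 2)
  adds-minus2 = adds-two (+ E.before) (- + (2 + E.before)) E.before∈ start∈ (eq (+ E.before))
    where
    eq : ∀ x → x ℤ.+ - (+ 2 ℤ.+ x) ≡ - + 2
    eq = ℤRing.solve-∀

data Paired : List ℕ → Set where
  []  : Paired []
  two : ∀ {a b es} → EvenSize a → EvenSize b → Paired es → Paired (a ∷ b ∷ es)

-- One `final` serves all fields: another choice of heads changes no label set. The sum 0 takes at
-- least two pairs, and `rest`, the sizes behind the first pair, tells whether there are that many.
record Descents (st : State) (es rest : List ℕ) : Set where
  field
    final : State
    minus1 : Adds st final es (- + 1)
    minus2 : Adds st final es (- + 2)
    none  : rest ≡ [] ⊎ Adds st final es (+ 0)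

-- The first pair gives 1 or -1 and the later ones -1 or -2 by induction: -1 = 1 - 2, -2 = -1 - 1, 0
-- = 1 - 1.
descents : ∀ st {a b es} → EvenSize a → EvenSize b → Paired es → Descents st (a ∷ b ∷ es) es
descents st {a} {b} ea eb [] = record
  { final = EvenStar.next F ; minus1 = adds-minus1 E F ; minus2 = adds-minus2 E F ; none = inj₁ refl }
  where
  E : EvenStar st a
  E = evenStar st ea
  F : EvenStar (EvenStar.next E) b
  F = evenStar _ eb
descents st {a} {b} {es} ea eb (two ec ed rest) = record
  { final = D.final
  ; minus1 = adds-++ (a ∷ b ∷ []) es (adds-plus1 E F) D.minus2
  ; minus2 = adds-++ (a ∷ b ∷ []) es (adds-minus1 E F) D.minus1
  ; none  = inj₂ (adds-++ (a ∷ b ∷ []) es (adds-plus1 E F) D.minus1)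
  }
  where
  E : EvenStar st a
  E = evenStar st ea
  F : EvenStar (EvenStar.next E) b
  F = evenStar _ eb
  module D = Descents (descents (EvenStar.next F) ec ed rest)

-- The first star shows a label just above the frontier and the pairs behind it correct by -1 or -2:
-- 1 = 3 - 2, 3 = 4 - 1, 0 = 1 - 1 relative to the frontier. `high` and `level` serve the cases
-- where the odd part cannot cancel `low`.
record OddRun (st : State) (es rest : List ℕ) : Set where
  field
    final : State
    low   : Adds st final es (+ (1 + frontier st))
    high  : Adds st final es (+ (3 + frontier st))
    level : rest ≡ [] ⊎ Adds st final es (+ frontier st)

oddRun : ∀ st {e es} → EvenSize e → Paired es → OddRun st (e ∷ es) es
oddRun st {e} ee [] = record
  { final = EvenStar.next E
  ; low   = adds-star E (+ (1 + frontier st)) (EvenStar.first∈ E)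
  ; high  = adds-star E (+ (3 + frontier st)) (EvenStar.third∈ E)
  ; level = inj₁ refl
  }
  where
  E : EvenStar st e
  E = evenStar st ee
oddRun st {e} {es} ee (two ea eb rest) = record
  { final = D.final
  ; low   = adds-≡ (low-≡ (+ frontier st)) (run (3 + frontier st) (EvenStar.third∈ E) D.minus2)
  ; high  = adds-≡ (high-≡ (+ frontier st)) (run (4 + frontier st) (EvenStar.fourth∈ E) D.minus1)
  ; level = inj₂ (adds-≡ (level-≡ (+ frontier st)) (run (1 + frontier st) (EvenStar.first∈ E) D.minus1))
  }
  where
  E : EvenStar st e
  E = evenStar st ee
  module D = Descents (descents (EvenStar.next E) ea eb rest)
  run : ∀ h {U} → h ∈ map ∣_∣ (EvenStar.values E) → Adds (EvenStar.next E) D.final es U →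
    Adds st D.final (e ∷ es) (+ h ℤ.+ U)
  run h h∈ ad = adds-++ (e ∷ []) es (adds-star E (+ h) h∈) ad
  low-≡ : ∀ x → (+ 3 ℤ.+ x) ℤ.+ - + 2 ≡ + 1 ℤ.+ x
  low-≡ = ℤRing.solve-∀
  high-≡ : ∀ x → (+ 4 ℤ.+ x) ℤ.+ - + 1 ≡ + 3 ℤ.+ x
  high-≡ = ℤRing.solve-∀
  level-≡ : ∀ x → (+ 1 ℤ.+ x) ℤ.+ - + 1 ≡ x
  level-≡ = ℤRing.solve-∀

-- Stars of odd size

-- (s , y , d) stands for an odd star with labels s, y and y + d.
Triple : Set
Triple = ℕ × ℕ × ℕ

tripleLabels : Triple → List ℕ
tripleLabels (s , y , d) = s ∷ y ∷ y + d ∷ []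

-- The members of the pair get opposite signs, so `y` drops out. The alternative `s + d` provides
-- the defects 2 = 1 + 1 and 3 = 1 + 2.
Off : Triple → ℕ → Set
Off (s , _ , d) a = a ≡ ∣ s - d ∣ ⊎ a ≡ s + d

∣m⊖n∣≡∣m-n∣ : ∀ m n → ∣ m ℤ.⊖ n ∣ ≡ ∣ m - n ∣
∣m⊖n∣≡∣m-n∣ zero    zero    = refl
∣m⊖n∣≡∣m-n∣ zero    (suc n) = refl
∣m⊖n∣≡∣m-n∣ (suc m) zero    = refl
∣m⊖n∣≡∣m-n∣ (suc m) (suc n) = ≡.trans (cong ∣_∣ (ℤ.[1+m]⊖[1+n]≡m⊖n m n)) (∣m⊖n∣≡∣m-n∣ m n)

signing : ∀ t {a} → Off t a → ∃ λ xs →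
  length xs ≡ 3 × ∣ total xs ∣ ≡ a × map ∣_∣ xs ≡ tripleLabels t
signing (s , y , d) (inj₁ refl) =
  + s ∷ + y ∷ - + (y + d) ∷ [] , refl ,
  ≡.trans (cong ∣_∣ (≡.trans (difference (+ s) (+ y) (+ d)) (ℤ.m-n≡m⊖n s d))) (∣m⊖n∣≡∣m-n∣ s d) ,
  cong (λ k → s ∷ y ∷ k ∷ []) (ℤ.∣-i∣≡∣i∣ (+ (y + d)))
  where
  difference : ∀ a b c → a ℤ.+ (b ℤ.+ (- (b ℤ.+ c) ℤ.+ + 0)) ≡ a ℤ.- c
  difference = ℤRing.solve-∀
signing (s , y , d) (inj₂ refl) =
  + s ∷ - + y ∷ + (y + d) ∷ [] , refl , cong ∣_∣ (collect (+ s) (+ y) (+ d)) ,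
  cong (λ k → s ∷ k ∷ y + d ∷ []) (ℤ.∣-i∣≡∣i∣ (+ y))
  where
  collect : ∀ a b c → a ℤ.+ (- b ℤ.+ ((b ℤ.+ c) ℤ.+ + 0)) ≡ a ℤ.+ c
  collect = ℤRing.solve-∀

data Heads : List Triple → ℤ → Set where
  []   : Heads [] (+ 0)
  cons : ∀ {t ts V} h → ∣ h ∣ ∈ tripleLabels t → Heads ts V → Heads (t ∷ ts) (h ℤ.+ V)

assemble : ∀ {ts ks V} → Pointwise Off ts ks → Heads ts V →
  Conf (concatMap tripleLabels ts) V (map (3 ,_) ks)
assemble [] [] = empty
assemble {t ∷ ts} {k ∷ ks} (off ∷ offs) (cons {V = V} h h∈ hs)
  with xs , len , sum≡ , abs ← signing t off =
  ≡.subst₂ (λ L n → Conf (L ++ _) (h ℤ.+ V) ((n , k) ∷ map (3 ,_) ks)) abs len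
    (add xs h sum≡ (subst (∣ h ∣ ∈_) (sym abs) h∈) (assemble offs hs))

fix-twos : ∀ {V} n {sp} → Solvable V (replicate n (3 , 2) ++ sp) → Solvable V (replicate n (5 , 0) ++ sp)
fix-twos zero    s = s
fix-twos (suc n) {sp} s =
  resolve (shift (5 , 0) (replicate n (5 , 0)) sp)
    (fix-twos n (resolve (↭-sym (shift (5 , 0) (replicate n (3 , 2)) sp)) (fix-two-solvable s)))

-- Above a full set the next four labels are two pairs of neighbours.
fix-ones : ∀ {V m sp} → Conf (used (full m)) V ((3 , 1) ∷ (3 , 1) ∷ sp) →
  Conf (used (full (4 + m))) V ((5 , 0) ∷ (5 , 0) ∷ sp)
fix-ones {m = m} c =
  attach (+ (4 + m) ∷ - + (3 + m) ∷ []) (cong ∣_∣ (difference (+ 3 ℤ.+ + m)))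
    (reorder (swap _ _ ↭-refl)
      (attach (+ (2 + m) ∷ - + (1 + m) ∷ []) (cong ∣_∣ (difference (+ 1 ℤ.+ + m))) c))
  where
  difference : ∀ x → (+ 1 ℤ.+ x) ℤ.+ (- x ℤ.+ + 0) ≡ + 1
  difference = ℤRing.solve-∀

-- In a gap state `1 + m` has no free neighbour, so defects of 1 cannot be repaired. Defects of 3
-- can: the pairs `1 + m`, `4 + m` and `3 + m`, `6 + m` leave a gap state again.
fix-threes : ∀ {V m sp} → Conf (used (gap m)) V ((3 , 3) ∷ (3 , 3) ∷ sp) →
  Conf (used (gap (4 + m))) V ((5 , 0) ∷ (5 , 0) ∷ sp)
fix-threes {m = m} c = relabel (select-↭ (0 ∷ 1 ∷ 0 ∷ 1 ∷ []) _)
  (attach (+ (6 + m) ∷ - + (3 + m) ∷ []) (cong ∣_∣ (difference (+ 3 ℤ.+ + m)))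
    (reorder (swap _ _ ↭-refl)
      (attach (+ (4 + m) ∷ - + (1 + m) ∷ []) (cong ∣_∣ (difference (+ 1 ℤ.+ + m))) c)))
  where
  difference : ∀ x → (+ 3 ℤ.+ x) ℤ.+ (- x ℤ.+ + 0) ≡ + 3
  difference = ℤRing.solve-∀

plain : ℕ → List ℕ → List Triple
plain s []       = []
plain s (y ∷ ys) = (s , y , s) ∷ plain (suc s) ys

-- In each of the first k groups of four triples the pairs belonging to the
-- small labels s, s + 2 and those belonging to s + 1, s + 3 are exchanged.
quads : ℕ → ℕ → List ℕ → List Triple
quads (suc k) s (a ∷ b ∷ c ∷ d ∷ ys) =
  (s , c , 2 + s) ∷ (1 + s , d , 3 + s) ∷ (2 + s , a , s) ∷ (3 + s , b , 1 + s) ∷ quads k (4 + s) ys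
quads _ s ys = plain s ys

quads-labels : ∀ k s ys → concatMap tripleLabels (plain s ys) ↭ concatMap tripleLabels (quads k s ys)
quads-labels zero s ys = ↭-refl
quads-labels (suc k) s (a ∷ b ∷ c ∷ d ∷ ys) = ↭-trans
  (select-↭ (0 ∷ 6 ∷ 6 ∷ 2 ∷ 6 ∷ 6 ∷ 4 ∷ 0 ∷ 0 ∷ 2 ∷ 0 ∷ 0 ∷ []) _)
  (++⁺ˡ (_ ∷ _ ∷ _ ∷ _ ∷ _ ∷ _ ∷ _ ∷ _ ∷ _ ∷ _ ∷ _ ∷ _ ∷ []) (quads-labels k (4 + s) ys))
quads-labels (suc k) s []                = ↭-refl
quads-labels (suc k) s (_ ∷ [])          = ↭-refl
quads-labels (suc k) s (_ ∷ _ ∷ [])      = ↭-refl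
quads-labels (suc k) s (_ ∷ _ ∷ _ ∷ [])  = ↭-refl

seg : ℕ → ℕ → List ℕ
seg s zero    = []
seg s (suc n) = s ∷ seg (suc s) n

plain-smalls : ∀ s ys → map proj₁ (plain s ys) ≡ seg s (length ys)
plain-smalls s []       = refl
plain-smalls s (y ∷ ys) = cong (s ∷_) (plain-smalls (suc s) ys)

quads-smalls : ∀ k s ys → map proj₁ (quads k s ys) ≡ seg s (length ys)
quads-smalls zero    s ys = plain-smalls s ys
quads-smalls (suc k) s (a ∷ b ∷ c ∷ d ∷ ys) =
  cong (λ l → s ∷ 1 + s ∷ 2 + s ∷ 3 + s ∷ l) (quads-smalls k (4 + s) ys)
quads-smalls (suc k) s []                = refl
quads-smalls (suc k) s (_ ∷ [])          = refl
quads-smalls (suc k) s (_ ∷ _ ∷ [])      = refl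
quads-smalls (suc k) s (_ ∷ _ ∷ _ ∷ [])  = refl

∣n-m+n∣≡m : ∀ m n → ∣ n - m + n ∣ ≡ m
∣n-m+n∣≡m m n = ≡.trans (cong (∣ n -_∣) (+-comm m n)) (ℕ.∣m-m+n∣≡n n m)

∣m+n-n∣≡m : ∀ m n → ∣ m + n - n ∣ ≡ m
∣m+n-n∣≡m m n = ≡.trans (ℕ.∣-∣-comm (m + n) n) (∣n-m+n∣≡m m n)

plain-off : ∀ s ys → Pointwise Off (plain s ys) (replicate (length ys) 0)
plain-off s []       = []
plain-off s (y ∷ ys) = inj₁ (sym (ℕ.∣n-n∣≡0 s)) ∷ plain-off (suc s) ys

quads-off : ∀ k {a} s ys → length ys ≡ k * 4 + a →
  Pointwise Off (quads k s ys) (replicate (k * 4) 2 ++ replicate a 0)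
quads-off zero    s ys refl = plain-off s ys
quads-off (suc k) s (a ∷ b ∷ c ∷ d ∷ ys) eq =
  inj₁ (sym (∣n-m+n∣≡m 2 s)) ∷ inj₁ (sym (∣n-m+n∣≡m 2 s)) ∷
  inj₁ (sym (∣m+n-n∣≡m 2 s)) ∷ inj₁ (sym (∣m+n-n∣≡m 2 (suc s))) ∷
  quads-off k (4 + s) ys (ℕ.suc-injective (ℕ.suc-injective (ℕ.suc-injective (ℕ.suc-injective eq))))

-- The even stars come between the triples and their repair, so every state `st` must be allowed.
-- The defects `ks` may depend on it, since the signs inside a triple are fixed only then.
Finishes : List Triple → ℕ → ℕ → Set
Finishes ts b a = ∀ st → ∃ λ ks → Pointwise Off ts ks ×
  (∀ {V sp} → Conf (used st) V (map (3 ,_) ks ++ sp) →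
    Solvable V (zeros (replicate b 5 ++ replicate a 3) ++ sp))

map-replicates : ∀ (f : ℕ → ℕ × ℕ) b x a y →
  map f (replicate b x ++ replicate a y) ≡ replicate b (f x) ++ replicate a (f y)
map-replicates f b x a y = ≡.trans (map-++ f (replicate b x) (replicate a y))
  (cong₂ _++_ (map-replicate f b x) (map-replicate f a y))

fix-body : ∀ {V sp} b a pre →
  Solvable V (pre ++ map (3 ,_) (replicate b 2 ++ replicate a 0) ++ sp) →
  Solvable V (pre ++ zeros (replicate b 5 ++ replicate a 3) ++ sp)
fix-body {sp = sp} b a pre s
  rewrite map-replicates (3 ,_) b 2 a 0 | map-replicates (_, 0) b 5 a 3
        | ++-assoc (replicate b (3 , 2)) (replicate a (3 , 0)) sp
        | ++-assoc (replicate b (5 , 0)) (replicate a (3 , 0)) sp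
  = resolve (shifts (replicate b (5 , 0)) pre)
      (fix-twos b (resolve (shifts pre (replicate b (3 , 2))) s))

module _ (k : ℕ) {a : ℕ} (s : ℕ) (ys : List ℕ) (eq : length ys ≡ k * 4 + a) where

  finishes₀ : Finishes (quads k s ys) (k * 4) a
  finishes₀ st = _ , quads-off k s ys eq , λ c → fix-body (k * 4) a [] (st , c)

  -- A star without a partner for an exchange gets its defect 2 as 1 + 1.
  finishes₁ : ∀ y → Finishes ((1 , y , 1) ∷ quads k s ys) (1 + k * 4) a
  finishes₁ y st = 2 ∷ _ , inj₂ refl ∷ quads-off k s ys eq ,
    λ c → fix-body (k * 4) a ((5 , 0) ∷ []) (fix-two-solvable (st , c))

  -- The same exchanged triples have the defects 2 - 1 or 2 + 1, depending on signs; the state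
  -- decides which of them is repairable.
  finishes₂ : ∀ y z → Finishes ((1 , z , 2) ∷ (2 , y , 1) ∷ quads k s ys) (2 + k * 4) a
  finishes₂ y z (full m) = 1 ∷ 1 ∷ _ , inj₁ refl ∷ inj₁ refl ∷ quads-off k s ys eq ,
    λ c → fix-body (k * 4) a ((5 , 0) ∷ (5 , 0) ∷ []) (full (4 + m) , fix-ones c)
  finishes₂ y z (gap m) = 3 ∷ 3 ∷ _ , inj₂ refl ∷ inj₂ refl ∷ quads-off k s ys eq ,
    λ c → fix-body (k * 4) a ((5 , 0) ∷ (5 , 0) ∷ []) (gap (4 + m) , fix-threes c)

  finishes₃ : ∀ x y z →
    Finishes ((1 , x , 1) ∷ (2 , z , 3) ∷ (3 , y , 2) ∷ quads k s ys) (3 + k * 4) a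
  finishes₃ x y z st = 2 ∷ 1 ∷ 1 ∷ _ ,
    inj₂ refl ∷ inj₁ refl ∷ inj₁ refl ∷ quads-off k s ys eq ,
    λ c → fix-body (k * 4) a ((5 , 0) ∷ (5 , 0) ∷ (5 , 0) ∷ []) (fix st c)
    where
    fix : ∀ {V sp} st → Conf (used st) V ((3 , 2) ∷ (3 , 1) ∷ (3 , 1) ∷ sp) →
      Solvable V ((5 , 0) ∷ (5 , 0) ∷ (5 , 0) ∷ sp)
    -- Defects of 1 require a full state, and repairing the defect 2 toggles it: that repair comes
    -- last from a full state and first from a gap.
    fix (full m) c = fix-two-solvable (full (4 + m) , reorder (select-↭ (2 ∷ []) _)
      (fix-ones (reorder (select-↭ (1 ∷ 1 ∷ []) _) c)))
    fix (gap m)  c = full (7 + m) , reorder (select-↭ (2 ∷ []) _)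
      (fix-ones (reorder (select-↭ (1 ∷ 1 ∷ []) _) (fix-two (gap m) c)))

-- Balancing the center

Solution : List ℕ → Set
Solution ns = ∃ λ V → Solvable V (zeros ns) × (3 ≤ length ns → V ≡ 0ℤ)

-- The three kinds of head sums serve when the number of even stars is even and
-- positive, zero, or odd, respectively.
record OddPart (b a : ℕ) : Set where
  field
    base     : State
    triples  : List Triple
    uses     : concatMap tripleLabels triples ↭ used base
    finishes : Finishes triples b a
    small    : Heads triples (+ 1) ⊎ Heads triples (+ 2)
    none     : (b + a ≤ 2 × ∃ (Heads triples)) ⊎ Heads triples (+ 0)
    large    : (b + a ≤ 1 × Heads triples (- + frontier base))
             ⊎ Heads triples (- + (1 + frontier base)) ⊎ Heads triples (- + (3 + frontier base))

pairUp : ∀ {es} → All EvenSize es →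
  Paired es ⊎ ∃₂ λ e es′ → es ≡ e ∷ es′ × EvenSize e × Paired es′
pairUp []            = inj₁ []
pairUp (e ∷ [])      = inj₂ (_ , _ , refl , e , [])
pairUp (d ∷ e ∷ ees) with pairUp ees
... | inj₁ ps                           = inj₁ (two d e ps)
... | inj₂ (_ , _ , refl , e′ , ps)     = inj₂ (_ , _ , refl , d , two e e′ ps)

few : ∀ {n V} → n ≤ 2 → 3 ≤ n → V ≡ 0ℤ
few n≤2 3≤n = contradiction (ℕ.≤-trans 3≤n n≤2) λ { (s≤s (s≤s ())) }

-- Without odd stars the frontier is 0 at the start, so `level` itself is the head sum 0.
even-solution : ∀ {es} → es ≢ [] → All EvenSize es → Solution es
even-solution {es} es≢[] ees = solve (pairUp ees)
  where
  start : Conf (used (full 0)) (+ 0) []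
  start = empty
  from : ∀ {st U} → Adds (full 0) st es U → Solvable (U ℤ.+ + 0) (zeros es)
  from {st} (adds f) = st , subst (Conf _ _) (++-identityʳ (zeros es)) (f start)
  solve : Paired es ⊎ (∃₂ λ e es′ → es ≡ e ∷ es′ × EvenSize e × Paired es′) → Solution es
  solve (inj₁ []) = contradiction refl es≢[]
  solve (inj₁ (two ea eb ps)) with descents (full 0) ea eb ps
  ... | record { minus1 = ad ; none = inj₁ refl } = _ , from ad , few ℕ.≤-refl
  ... | record { none = inj₂ ad }                 = _ , from ad , λ _ → refl
  solve (inj₂ (_ , _ , refl , ee , ps)) with oddRun (full 0) ee ps
  ... | record { low = ad ; level = inj₁ refl } = _ , from ad , few (s≤s z≤n)
  ... | record { level = inj₂ ad }              = _ , from ad , λ _ → refl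

module _ {b a : ℕ} (odd : OddPart b a) where
  open OddPart odd

  private
    odds : List ℕ
    odds = replicate b 5 ++ replicate a 3

    odds-length : length odds ≡ b + a
    odds-length = ≡.trans (length-++ (replicate b 5))
      (cong₂ _+_ (length-replicate b) (length-replicate a))

    combine : ∀ {st es T U} → Heads triples T → Adds base st es U →
      Solvable (U ℤ.+ T) (zeros (odds ++ es))
    combine {st} {es} hs (adds f) with ks , offs , finish ← finishes st
      rewrite map-++ (_, 0) odds es =
      finish (reorder (++-comm (zeros es) (map (3 ,_) ks)) (f (relabel uses (assemble offs hs))))

    few′ : ∀ {es V} → b + a + length es ≤ 2 → 3 ≤ length (odds ++ es) → V ≡ 0ℤ
    few′ {es} le rewrite length-++ odds {es} | odds-length = few le

    adds-nothing : Adds base base [] (+ 0)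
    adds-nothing = adds λ {W} c → subst (λ V → Conf _ V _) (sym (ℤ.+-identityˡ W)) c

  odd-solution : ∀ {es} → All EvenSize es → Solution (odds ++ es)
  odd-solution {es} ees = solve (pairUp ees)
    where
    solve : Paired es ⊎ (∃₂ λ e es′ → es ≡ e ∷ es′ × EvenSize e × Paired es′) → Solution (odds ++ es)
    solve (inj₁ []) with none
    ... | inj₁ (le , T , hs) = _ , combine hs adds-nothing , 
      few′ {[]} (ℕ.≤-trans (ℕ.≤-reflexive (ℕ.+-identityʳ (b + a))) le)
    ... | inj₂ hs            = _ , combine hs adds-nothing , λ _ → refl
    solve (inj₁ (two ea eb ps)) with small
    ... | inj₁ hs = _ , combine hs (Descents.minus1 (descents base ea eb ps)) , λ _ → refl
    ... | inj₂ hs = _ , combine hs (Descents.minus2 (descents base ea eb ps)) , λ _ → refl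
    solve (inj₂ (_ , _ , refl , ee , ps)) with large | oddRun base ee ps
    ... | inj₂ (inj₁ hs) | record { low = ad }  = _ , combine hs ad , λ _ → ℤ.+-inverseʳ (+ (1 + frontier base))
    ... | inj₂ (inj₂ hs) | record { high = ad } = _ , combine hs ad , λ _ → ℤ.+-inverseʳ (+ (3 + frontier base))
    ... | inj₁ (le , hs) | record { level = inj₂ ad } = _ , combine hs ad , λ _ → ℤ.+-inverseʳ (+ frontier base)
    ... | inj₁ (le , hs) | record { low = ad ; level = inj₁ refl } =
      _ , combine hs ad , few′ {_ ∷ []} (ℕ.+-monoˡ-≤ 1 le)

-- Signed sums of the small labels

data Split : List ℕ → ℕ → ℕ → Set where
  []    : Split [] 0 0
  left  : ∀ {x xs u v} → Split xs u v → Split (x ∷ xs) (x + u) v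
  right : ∀ {x xs u v} → Split xs u v → Split (x ∷ xs) u (x + v)

split-≡ : ∀ {xs u u′ v v′} → u ≡ u′ → v ≡ v′ → Split xs u v → Split xs u′ v′
split-≡ refl refl s = s

split-↭ : ∀ {xs ys u v} → xs ↭ ys → Split xs u v → Split ys u v
split-↭ refl s = s
split-↭ (prep x p) (left s)  = left (split-↭ p s)
split-↭ (prep x p) (right s) = right (split-↭ p s)
split-↭ (swap x y p) (left (left {u = u} s)) =
  split-≡ (exchange y x u) refl (left (left (split-↭ p s)))
  where
  exchange : ∀ a b c → a + (b + c) ≡ b + (a + c)
  exchange = ℕRing.solve-∀
split-↭ (swap x y p) (left (right s))  = right (left (split-↭ p s))
split-↭ (swap x y p) (right (left s))  = left (right (split-↭ p s))
split-↭ (swap x y p) (right (right {v = v} s)) =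
  split-≡ refl (exchange y x v) (right (right (split-↭ p s)))
  where
  exchange : ∀ a b c → a + (b + c) ≡ b + (a + c)
  exchange = ℕRing.solve-∀
split-↭ (trans p q) s = split-↭ q (split-↭ p s)

-- The margin `c` excludes sides near 0 and near the total: no part of 2, 3, 4 has the sum 1 or 8.
Full : ℕ → List ℕ → Set
Full c xs = ∀ u v → c ≤ u → c ≤ v → u + v ≡ sum xs → Split xs u v

-- The new number goes to a side that is at least `n + c`, so that at least `c` remains there. If
-- both sides were smaller, the total would be at most 2(n + c) - 2, against `bound`.
full-extend : ∀ c {n xs} → n + (c + c) ≤ suc (sum xs) → Full c xs → Full c (n ∷ xs)
full-extend c {n} {xs} bound f u v c≤u c≤v eq with (n + c) ℕ.≤? u | (n + c) ℕ.≤? v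
... | yes le | _ with k , refl ← ℕ.m≤n⇒∃[o]m+o≡n le
  = split-≡ (sym (+-assoc n c k)) refl
      (left (f (c + k) v (ℕ.m≤m+n c k) c≤v (ℕ.+-cancelˡ-≡ n _ _ (≡.trans (regroup n c k v) eq))))
  where
  regroup : ∀ n c k v → n + ((c + k) + v) ≡ ((n + c) + k) + v
  regroup = ℕRing.solve-∀
... | no _ | yes le with k , refl ← ℕ.m≤n⇒∃[o]m+o≡n le
  = split-≡ refl (sym (+-assoc n c k))
      (right (f u (c + k) c≤u (ℕ.m≤m+n c k) (ℕ.+-cancelˡ-≡ n _ _ (≡.trans (regroup n c k u) eq))))
  where
  regroup : ∀ n c k u → n + (u + (c + k)) ≡ u + ((n + c) + k)
  regroup = ℕRing.solve-∀
... | no n+c≰u | no n+c≰v = contradiction too-small (ℕ.<-irrefl refl)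
  where
  open ℕ.≤-Reasoning
  regroup : ∀ n c → (n + c) + (n + c) ≡ n + (n + (c + c))
  regroup = ℕRing.solve-∀
  too-small : suc (n + sum xs) < suc (n + sum xs)
  too-small = begin-strict
    suc (n + sum xs)        ≡⟨ cong suc eq ⟨
    suc (u + v)             <⟨ ℕ.≤-reflexive (cong suc (sym (ℕ.+-suc u v))) ⟩
    suc u + suc v           ≤⟨ ℕ.+-mono-≤ (ℕ.≰⇒> n+c≰u) (ℕ.≰⇒> n+c≰v) ⟩
    (n + c) + (n + c)       ≡⟨ regroup n c ⟩
    n + (n + (c + c))       ≤⟨ ℕ.+-monoʳ-≤ n bound ⟩
    n + suc (sum xs)        ≡⟨ ℕ.+-suc n (sum xs) ⟩
    suc (n + sum xs)        ∎

full-↭ : ∀ {c xs ys} → xs ↭ ys → Full c xs → Full c ys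
full-↭ p f u v c≤u c≤v eq = split-↭ p (f u v c≤u c≤v (≡.trans eq (sum-↭ (↭-sym p))))

seg-++ : ∀ s m n → seg s (m + n) ≡ seg s m ++ seg (s + m) n
seg-++ s zero    n = cong (λ k → seg k n) (sym (ℕ.+-identityʳ s))
seg-++ s (suc m) n = cong (s ∷_) (≡.trans (seg-++ (suc s) m n)
  (cong (λ k → seg (suc s) m ++ seg k n) (sym (ℕ.+-suc s m))))

seg-suc : ∀ s n → seg s (suc n) ↭ s + n ∷ seg s n
seg-suc s n = ↭-trans (↭-reflexive (≡.trans (cong (seg s) (+-comm 1 n)) (seg-++ s n 1)))
  (↭-sym (∷↭∷ʳ (s + n) (seg s n)))

n≤sum-seg : ∀ s n → n ≤ sum (seg (suc s) n)
n≤sum-seg s zero    = z≤n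
n≤sum-seg s (suc n) = s≤s (ℕ.≤-trans (n≤sum-seg (suc s) n) (ℕ.m≤n+m _ s))

full-seg : ∀ n → Full 0 (seg 1 n)
full-seg zero zero zero _ _ _ = []
full-seg (suc n) = full-↭ (↭-sym (seg-suc 1 n))
  (full-extend 0 (s≤s (ℕ.≤-trans (ℕ.≤-reflexive (ℕ.+-identityʳ n)) (n≤sum-seg 0 n))) (full-seg n))

-- For q = 4 + n odd stars the small labels 1, …, q have the sum 10 + R n.
R : ℕ → ℕ
R n = sum (seg 5 n)

-- The bound persists: each appended number exceeds the previous one by 1, while the sum grows by
-- more.
full-++-seg : ∀ c xs → 5 + (c + c) ≤ suc (sum xs) → Full c xs → ∀ n → Full c (xs ++ seg 5 n)
full-++-seg c xs bound f zero = subst (Full c) (sym (++-identityʳ xs)) f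
full-++-seg c xs bound f (suc n) =
  full-↭ (↭-sym (↭-trans (++⁺ˡ xs (seg-suc 5 n)) (shift (5 + n) xs (seg 5 n))))
    (full-extend c bound′ (full-++-seg c xs bound f n))
  where
  open ℕ.≤-Reasoning
  regroup : ∀ n c → 5 + n + c ≡ (5 + c) + n
  regroup = ℕRing.solve-∀
  bound′ : 5 + n + (c + c) ≤ suc (sum (xs ++ seg 5 n))
  bound′ = begin
    5 + n + (c + c)               ≡⟨ regroup n (c + c) ⟩
    (5 + (c + c)) + n             ≤⟨ ℕ.+-mono-≤ bound (n≤sum-seg 4 n) ⟩
    suc (sum xs) + R n            ≡⟨ cong suc (sum-++ xs (seg 5 n)) ⟨
    suc (sum (xs ++ seg 5 n))     ∎

-- Signed sums of the small labels other than that of the flexible star; the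
-- offset j does not influence the difference of the two sides.
Reach : List ℕ → ℕ → Set
Reach xs n = ∃ λ j → ∀ u v → 1 ≤ u → 1 ≤ v → u + v ≡ 7 + R n → Split xs (j + u) (j + v)

-- Here 2 + 3 + 4 = 7 + 2, and the margin 2 turns into `1 ≤ u` and `1 ≤ v` by the offset 1 on each
-- side.
reach-without-1 : ∀ n → Reach (2 ∷ 3 ∷ 4 ∷ seg 5 n) n
reach-without-1 n = 1 , λ u v 1≤u 1≤v eq →
  full-++-seg 2 (2 ∷ 3 ∷ 4 ∷ []) (ℕ.n≤1+n 9) initial n (suc u) (suc v) (s≤s 1≤u) (s≤s 1≤v)
    (cong suc (≡.trans (ℕ.+-suc u v) (cong suc eq)))
  where
  initial : Full 2 (2 ∷ 3 ∷ 4 ∷ [])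
  initial 0 v () _ _
  initial 1 v (s≤s ()) _ _
  initial 2 .7 _ _ refl = left (right (right []))
  initial 3 .6 _ _ refl = right (left (right []))
  initial 4 .5 _ _ refl = right (right (left []))
  initial 5 .4 _ _ refl = left (left (right []))
  initial 6 .3 _ _ refl = left (right (left []))
  initial 7 .2 _ _ refl = right (left (left []))
  initial 8 .1 _ (s≤s ()) refl
  initial 9 .0 _ () refl
  initial (suc (suc (suc (suc (suc (suc (suc (suc (suc (suc u)))))))))) v _ _ ()

reach-without-3 : ∀ n → Reach (1 ∷ 2 ∷ 4 ∷ seg 5 n) n
reach-without-3 n = 0 , λ u v _ _ →
  full-++-seg 0 (1 ∷ 2 ∷ 4 ∷ []) (ℕ.m≤m+n 5 3) initial n u v z≤n z≤n
  where
  initial : Full 0 (1 ∷ 2 ∷ 4 ∷ [])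
  initial = full-↭ (select-↭ (1 ∷ 1 ∷ []) _)
    (full-extend 0 ℕ.≤-refl (full-seg 2))

heads-≡ : ∀ {ts V V′} → V ≡ V′ → Heads ts V → Heads ts V′
heads-≡ refl hs = hs

heads-split : ∀ ts {u v} → Split (map proj₁ ts) u v → Heads ts (+ v ℤ.- + u)
heads-split []       []                          = []
heads-split (t ∷ ts) (left {u = u} {v} s) =
  heads-≡ (eq (+ proj₁ t) (+ u) (+ v)) (cons (- + proj₁ t) (here (ℤ.∣-i∣≡∣i∣ (+ proj₁ t))) (heads-split ts s))
  where
  eq : ∀ x u v → - x ℤ.+ (v ℤ.- u) ≡ v ℤ.- (x ℤ.+ u)
  eq = ℤRing.solve-∀
heads-split (t ∷ ts) (right {u = u} {v} s) =
  heads-≡ (sym (ℤ.+-assoc (+ proj₁ t) (+ v) (- + u))) (cons (+ proj₁ t) (here refl) (heads-split ts s))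

heads-flexible : ∀ pre {t post u v} h → ∣ h ∣ ∈ tripleLabels t → Split (map proj₁ (pre ++ post)) u v →
  Heads (pre ++ t ∷ post) (h ℤ.+ (+ v ℤ.- + u))
heads-flexible []        {post = post} h h∈ s = cons h h∈ (heads-split post s)
heads-flexible (t ∷ pre) h h∈ (left {u = u} {v} s) =
  heads-≡ (eq (+ proj₁ t) h (+ u) (+ v)) (cons (- + proj₁ t) (here (ℤ.∣-i∣≡∣i∣ (+ proj₁ t))) (heads-flexible pre h h∈ s))
  where
  eq : ∀ x h u v → - x ℤ.+ (h ℤ.+ (v ℤ.- u)) ≡ h ℤ.+ (v ℤ.- (x ℤ.+ u))
  eq = ℤRing.solve-∀
heads-flexible (t ∷ pre) h h∈ (right {u = u} {v} s) =
  heads-≡ (eq (+ proj₁ t) h (+ u) (+ v)) (cons (+ proj₁ t) (here refl) (heads-flexible pre h h∈ s))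
  where
  eq : ∀ x h u v → x ℤ.+ (h ℤ.+ (v ℤ.- u)) ≡ h ℤ.+ ((x ℤ.+ v) ℤ.- u)
  eq = ℤRing.solve-∀

halve-≤ : ∀ {m n} → m + m ≤ n + n → m ≤ n
halve-≤ {m} {n} le with m ℕ.≤? n
... | yes m≤n = m≤n
... | no m≰n  = contradiction (ℕ.≤-trans (ℕ.+-mono-< (ℕ.≰⇒> m≰n) (ℕ.≰⇒> m≰n)) le) (ℕ.<-irrefl refl)

half : ∀ n → (∃ λ k → n ≡ k + k) ⊎ (∃ λ k → n ≡ suc (k + k))
half zero = inj₁ (0 , refl)
half (suc n) with half n
... | inj₁ (k , refl) = inj₂ (k , refl)
... | inj₂ (k , refl) = inj₁ (suc k , cong suc (sym (ℕ.+-suc k k)))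

-- An even label k + k of the pair y, y + d, together with the bounds under
-- which it can be balanced at the center by the remaining small labels.
record Flexible (n N y d : ℕ) : Set where
  field
    k     : ℕ
    k∈    : k + k ∈ y ∷ y + d ∷ []
    upper : k + k ≤ 6 + R n + N
    lower : N ≤ 4 + R n + (k + k)
    tight : ∀ w → 7 + R n ≡ w + w → k + k ≤ 5 + R n

module _ {n N s y d : ℕ} {post : List Triple} (pre : List Triple) (F : Flexible n N y d)
         (reach : Reach (map proj₁ (pre ++ post)) n) where
  open Flexible F

  private
    j : ℕ
    j = proj₁ reach

  -- The equations 2k + v - u = 0 and u + v = 7 + R n = 2w give u = w + k and v = w - k; `tight`
  -- says that v is positive.
  heads-zero : ∀ w → 7 + R n ≡ w + w → Heads (pre ++ (s , y , d) ∷ post) (+ 0)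
  heads-zero w even = balance (ℕ.m≤n⇒∃[o]m+o≡n k<w)
    where
    open ℕ.≤-Reasoning
    k<w : suc k ≤ w
    k<w = halve-≤ (begin
      suc k + suc k    ≡⟨ cong suc (ℕ.+-suc k k) ⟩
      2 + (k + k)      ≤⟨ ℕ.+-monoʳ-≤ 2 (tight w even) ⟩
      7 + R n          ≡⟨ even ⟩
      w + w            ∎)
    sum≡ : ∀ k o → (k + k + suc o) + suc o ≡ (suc k + o) + (suc k + o)
    sum≡ = ℕRing.solve-∀
    value : ∀ j o → + (k + k) ℤ.+ (+ (j + o) ℤ.- + (j + (k + k + o))) ≡ + 0
    value j o = identity (+ (k + k)) (+ j) (+ o)
      where
      identity : ∀ e j o → e ℤ.+ ((j ℤ.+ o) ℤ.- (j ℤ.+ (e ℤ.+ o))) ≡ + 0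
      identity = ℤRing.solve-∀
    balance : (∃ λ o → suc k + o ≡ w) → Heads (pre ++ (s , y , d) ∷ post) (+ 0)
    balance (o , refl) = heads-≡ (value j (suc o)) (heads-flexible pre (+ (k + k)) (there k∈)
      (proj₂ reach (k + k + suc o) (suc o) (ℕ.≤-trans (s≤s z≤n) (ℕ.m≤n+m (suc o) (k + k))) (s≤s z≤n)
        (≡.trans (sum≡ k o) (sym even))))

  -- The equations -2k + v - u = -(1 + N) and u + v = 7 + R n give u = w - k and v = w + k - (1 +
  -- N). Positivity of u is `upper`, that of v is `lower`.
  heads-large : ∀ w → 8 + R n + N ≡ w + w → Heads (pre ++ (s , y , d) ∷ post) (- + (1 + N))
  heads-large w even = balance (ℕ.m≤n⇒∃[o]m+o≡n k<w) (ℕ.m≤n⇒∃[o]m+o≡n N<w+k)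
    where
    open ℕ.≤-Reasoning
    k<w : suc k ≤ w
    k<w = halve-≤ (begin
      suc k + suc k      ≡⟨ cong suc (ℕ.+-suc k k) ⟩
      2 + (k + k)        ≤⟨ ℕ.+-monoʳ-≤ 2 upper ⟩
      8 + R n + N        ≡⟨ even ⟩
      w + w              ∎)
    double : ∀ r k N → (4 + r + k) + (4 + N) ≡ (8 + r + N) + k
    double = ℕRing.solve-∀
    double′ : ∀ N → (2 + N) + (2 + N) ≡ N + (4 + N)
    double′ = ℕRing.solve-∀
    double″ : ∀ w k → (w + w) + (k + k) ≡ (w + k) + (w + k)
    double″ = ℕRing.solve-∀
    N<w+k : 2 + N ≤ w + k
    N<w+k = halve-≤ (begin
      (2 + N) + (2 + N)                 ≡⟨ double′ N ⟩
      N + (4 + N)                       ≤⟨ ℕ.+-monoˡ-≤ (4 + N) lower ⟩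
      (4 + R n + (k + k)) + (4 + N)     ≡⟨ double (R n) (k + k) N ⟩
      (8 + R n + N) + (k + k)           ≡⟨ cong (_+ (k + k)) even ⟩
      (w + w) + (k + k)                 ≡⟨ double″ w k ⟩
      (w + k) + (w + k)                 ∎)
    balance : (∃ λ o → suc k + o ≡ w) → (∃ λ p → 2 + N + p ≡ w + k) →
      Heads (pre ++ (s , y , d) ∷ post) (- + (1 + N))
    balance (o , refl) (p , eq) = heads-≡ value
      (heads-flexible pre (- + (k + k)) (there (subst (_∈ y ∷ y + d ∷ []) (sym (ℤ.∣-i∣≡∣i∣ (+ (k + k)))) k∈))
        (proj₂ reach (suc o) (suc p) (s≤s z≤n) (s≤s z≤n) (ℕ.+-cancelʳ-≡ (suc N) _ _ sum≡)))
      where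
      shuffle : ∀ o p N → (suc o + suc p) + suc N ≡ suc o + (2 + N + p)
      shuffle = ℕRing.solve-∀
      shuffle′ : ∀ o k → suc o + ((suc k + o) + k) ≡ (suc k + o) + (suc k + o)
      shuffle′ = ℕRing.solve-∀
      shuffle″ : ∀ r N → 8 + r + N ≡ (7 + r) + suc N
      shuffle″ = ℕRing.solve-∀
      sum≡ : (suc o + suc p) + suc N ≡ (7 + R n) + suc N
      sum≡ = begin-equality
        (suc o + suc p) + suc N           ≡⟨ shuffle o p N ⟩
        suc o + (2 + N + p)               ≡⟨ cong (_+_ (suc o)) eq ⟩
        suc o + ((suc k + o) + k)         ≡⟨ shuffle′ o k ⟩
        (suc k + o) + (suc k + o)         ≡⟨ even ⟨
        8 + R n + N                       ≡⟨ shuffle″ (R n) N ⟩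
        (7 + R n) + suc N                 ∎
      identity : ∀ j k o p N → - (k ℤ.+ k) ℤ.+ ((j ℤ.+ (+ 1 ℤ.+ p)) ℤ.- (j ℤ.+ (+ 1 ℤ.+ o)))
        ≡ ((+ 2 ℤ.+ N ℤ.+ p) ℤ.- ((+ 1 ℤ.+ k ℤ.+ o) ℤ.+ k)) ℤ.+ - (+ 1 ℤ.+ N)
      identity = ℤRing.solve-∀
      value : - + (k + k) ℤ.+ (+ (j + suc p) ℤ.- + (j + suc o)) ≡ - + (1 + N)
      value = ≡.trans (identity (+ j) (+ k) (+ o) (+ p) (+ N))
        (≡.trans (cong (λ i → (i ℤ.- + ((suc k + o) + k)) ℤ.+ - + (1 + N)) (cong +_ eq))
          (≡.trans (cong (ℤ._+ - + (1 + N)) (ℤ.+-inverseʳ (+ ((suc k + o) + k)))) (ℤ.+-identityˡ _)))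

-- All small labels together have the sum 10 + R n. If it is even, they reach 0 and 2 by themselves;
-- if it is odd, they reach 1, and 0 takes the flexible star. The large head sum always takes it,
-- since 10 + R n and the frontier have equal parity.
oddPart-from : ∀ {b a} n base pre {s y d post} → let ts = pre ++ (s , y , d) ∷ post in
  concatMap tripleLabels ts ↭ used base → Finishes ts b a → map proj₁ ts ≡ seg 1 (4 + n) →
  Reach (map proj₁ (pre ++ post)) n → Flexible n (frontier base) y d →
  (∃ λ w → 8 + R n + frontier base ≡ w + w) → OddPart b a
oddPart-from {b} {a} n base pre {s} {y} {d} {post} uses finishes smalls reach flexible (w , even) = record
  { base     = base
  ; triples  = ts
  ; uses     = uses
  ; finishes = finishes
  ; small    = small (half (10 + R n))
  ; none     = inj₂ (none (half (10 + R n)))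
  ; large    = inj₂ (inj₁ (heads-large pre flexible reach w even))
  }
  where
  ts : List Triple
  ts = pre ++ (s , y , d) ∷ post
  signed : ∀ u v → u + v ≡ 10 + R n → Heads ts (+ v ℤ.- + u)
  signed u v eq = heads-split ts (subst (λ l → Split l u v) (sym smalls) (full-seg (4 + n) u v z≤n z≤n eq))
  small : (∃ λ k → 10 + R n ≡ k + k) ⊎ (∃ λ k → 10 + R n ≡ suc (k + k)) → Heads ts (+ 1) ⊎ Heads ts (+ 2)
  small (inj₁ (suc k , eq)) = inj₂ (heads-≡ (difference (+ k)) (signed k (2 + k) (≡.trans (shuffle k) (sym eq))))
    where
    shuffle : ∀ k → k + (2 + k) ≡ suc k + suc k
    shuffle = ℕRing.solve-∀
    difference : ∀ k → (+ 2 ℤ.+ k) ℤ.- k ≡ + 2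
    difference = ℤRing.solve-∀
  small (inj₂ (k , eq)) = inj₁ (heads-≡ (difference (+ k)) (signed k (suc k) (≡.trans (ℕ.+-suc k k) (sym eq))))
    where
    difference : ∀ k → (+ 1 ℤ.+ k) ℤ.- k ≡ + 1
    difference = ℤRing.solve-∀
  none : (∃ λ k → 10 + R n ≡ k + k) ⊎ (∃ λ k → 10 + R n ≡ suc (k + k)) → Heads ts (+ 0)
  none (inj₁ (k , eq)) = heads-≡ (ℤ.+-inverseʳ (+ k)) (signed k k (sym eq))
  none (inj₂ (suc k , eq)) = heads-zero pre flexible reach k
    (ℕ.suc-injective (ℕ.suc-injective (ℕ.suc-injective (≡.trans eq (cong (λ i → suc (suc i)) (ℕ.+-suc k k))))))

-- From Skolem triples to the odd part

record Skolem (n : ℕ) : Set where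
  field
    base     : State
    ys       : List ℕ
    count    : length ys ≡ 4 + n
    uses     : concatMap tripleLabels (plain 1 ys) ↭ used base
    parity   : ∃ λ w → 8 + R n + frontier base ≡ w + w
    flexible : All (λ { (_ , y , d) → ∀ k → d ≡ suc (k + k) → Flexible n (frontier base) y d }) (plain 1 ys)

suc⁴ : ∀ {m n} → 4 + m ≡ 4 + n → m ≡ n
suc⁴ refl = refl

-- After the exchange of the first two pairs neither of these stars has both an odd small label and
-- an odd difference. The flexible star is the one with small label 3, which holds the pair of
-- difference 5 after the exchange of the next four.
skolem-oddPart₆ : ∀ {n} k a → 6 + k * 4 + a ≡ 4 + n → Skolem n → OddPart (6 + k * 4) a
skolem-oddPart₆ k a () record { ys = _ ∷ _ ∷ _ ∷ _ ∷ [] ; count = refl }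
skolem-oddPart₆ k a () record { ys = _ ∷ _ ∷ _ ∷ _ ∷ _ ∷ [] ; count = refl }
skolem-oddPart₆ k a b+a≡
  record { base = base ; ys = ys@(y₁ ∷ y₂ ∷ y₃ ∷ y₄ ∷ y₅ ∷ y₆ ∷ rest) ; count = refl ; uses = uses
         ; parity = parity ; flexible = _ ∷ _ ∷ _ ∷ _ ∷ f₅ ∷ _ } =
  oddPart-from (2 + length rest) base ((1 , y₂ , 2) ∷ (2 , y₁ , 1) ∷ [])
    (↭-trans (↭-trans (select-↭ (0 ∷ 3 ∷ 3 ∷ 2 ∷ 0 ∷ 0 ∷ []) _)
      (++⁺ˡ (_ ∷ _ ∷ _ ∷ _ ∷ _ ∷ _ ∷ []) (↭-sym (quads-labels (suc k) 3 (y₃ ∷ y₄ ∷ y₅ ∷ y₆ ∷ rest))))) uses)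
    (finishes₂ (suc k) 3 (y₃ ∷ y₄ ∷ y₅ ∷ y₆ ∷ rest) (ℕ.suc-injective (ℕ.suc-injective (sym b+a≡))) y₁ y₂)
    (cong (λ l → 1 ∷ 2 ∷ 3 ∷ 4 ∷ 5 ∷ 6 ∷ l) (quads-smalls k 7 rest))
    (subst (λ l → Reach (1 ∷ 2 ∷ 4 ∷ 5 ∷ 6 ∷ l) (2 + length rest)) (sym (quads-smalls k 7 rest)) (reach-without-3 (2 + length rest)))
    (f₅ 2 refl) parity

-- The flexible star needs an odd small label, to change the parity, and a pair of odd difference,
-- to contain an even label. Star 1 qualifies with its own pair for b = 0 and b ≡ 1, 3 (mod 4), and
-- with the pair of difference 3 for the other b ≡ 0. For b = 2 it is star 3 with its own pair.
skolem-oddPart : ∀ {n} b a → b + a ≡ 4 + n → Skolem n → OddPart b a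
skolem-oddPart {n} b a b+a≡
  record { base = base ; ys = ys@(y₁ ∷ y₂ ∷ y₃ ∷ y₄ ∷ rest) ; count = count ; uses = uses ; parity = parity
         ; flexible = f₁ ∷ f₂ ∷ f₃ ∷ f₄ ∷ gs }
  with b divMod 4
... | result zero fzero refl =
  oddPart-from n base [] uses (finishes₀ 0 1 ys (≡.trans count (sym b+a≡)))
    (≡.trans (plain-smalls 1 ys) (cong (seg 1) count))
    (subst (λ l → Reach l n) (sym (others rest (suc⁴ count))) (reach-without-1 n))
    (f₁ 0 refl) parity
  where
  others : ∀ rest → length rest ≡ n → map proj₁ (plain 2 (y₂ ∷ y₃ ∷ y₄ ∷ rest)) ≡ 2 ∷ 3 ∷ 4 ∷ seg 5 n
  others rest refl = plain-smalls 2 (y₂ ∷ y₃ ∷ y₄ ∷ rest)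
... | result (suc k) fzero refl =
  oddPart-from n base [] (↭-trans (↭-sym (quads-labels (suc k) 1 ys)) uses)
    (finishes₀ (suc k) 1 ys (≡.trans count (sym b+a≡)))
    (≡.trans (quads-smalls (suc k) 1 ys) (cong (seg 1) count))
    (subst (λ l → Reach l n) (sym (others (suc⁴ count))) (reach-without-1 n))
    (f₃ 1 refl) parity
  where
  others : length rest ≡ n → 2 ∷ 3 ∷ 4 ∷ map proj₁ (quads k 5 rest) ≡ 2 ∷ 3 ∷ 4 ∷ seg 5 n
  others refl = cong (λ l → 2 ∷ 3 ∷ 4 ∷ l) (quads-smalls k 5 rest)
... | result k (fsuc fzero) refl =
  oddPart-from n base [] (↭-trans (++⁺ˡ (_ ∷ _ ∷ _ ∷ []) (↭-sym (quads-labels k 2 (y₂ ∷ y₃ ∷ y₄ ∷ rest)))) uses)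
    (finishes₁ k 2 (y₂ ∷ y₃ ∷ y₄ ∷ rest) (ℕ.suc-injective (≡.trans count (sym b+a≡))) y₁)
    (cong (1 ∷_) (others (suc⁴ count)))
    (subst (λ l → Reach l n) (sym (others (suc⁴ count))) (reach-without-1 n))
    (f₁ 0 refl) parity
  where
  others : length rest ≡ n → map proj₁ (quads k 2 (y₂ ∷ y₃ ∷ y₄ ∷ rest)) ≡ 2 ∷ 3 ∷ 4 ∷ seg 5 n
  others refl = quads-smalls k 2 (y₂ ∷ y₃ ∷ y₄ ∷ rest)
... | result k (fsuc (fsuc (fsuc fzero))) refl =
  oddPart-from n base [] (↭-trans (↭-trans (select-↭ (0 ∷ 0 ∷ 0 ∷ 0 ∷ 3 ∷ 3 ∷ 2 ∷ 0 ∷ 0 ∷ []) _)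
      (++⁺ˡ (_ ∷ _ ∷ _ ∷ _ ∷ _ ∷ _ ∷ _ ∷ _ ∷ _ ∷ []) (↭-sym (quads-labels k 4 (y₄ ∷ rest))))) uses)
    (finishes₃ k 4 (y₄ ∷ rest) (ℕ.suc-injective (ℕ.suc-injective (ℕ.suc-injective (≡.trans count (sym b+a≡))))) y₁ y₂ y₃)
    (cong (1 ∷_) (others (suc⁴ count)))
    (subst (λ l → Reach l n) (sym (others (suc⁴ count))) (reach-without-1 n))
    (f₁ 0 refl) parity
  where
  others : length rest ≡ n → 2 ∷ 3 ∷ map proj₁ (quads k 4 (y₄ ∷ rest)) ≡ 2 ∷ 3 ∷ 4 ∷ seg 5 n
  others refl = cong (λ l → 2 ∷ 3 ∷ l) (quads-smalls k 4 (y₄ ∷ rest))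
... | result zero (fsuc (fsuc fzero)) refl =
  oddPart-from n base ((1 , y₂ , 2) ∷ (2 , y₁ , 1) ∷ [])
    (↭-trans (select-↭ (0 ∷ 3 ∷ 3 ∷ 2 ∷ 0 ∷ 0 ∷ []) _) uses)
    (finishes₂ 0 3 (y₃ ∷ y₄ ∷ rest) (ℕ.suc-injective (ℕ.suc-injective (≡.trans count (sym b+a≡)))) y₁ y₂)
    (≡.trans (plain-smalls 1 ys) (cong (seg 1) count))
    (subst (λ l → Reach l n) (sym (others (suc⁴ count))) (reach-without-3 n))
    (f₃ 1 refl) parity
  where
  others : length rest ≡ n → 1 ∷ 2 ∷ map proj₁ (plain 4 (y₄ ∷ rest)) ≡ 1 ∷ 2 ∷ 4 ∷ seg 5 n
  others refl = cong (λ l → 1 ∷ 2 ∷ l) (plain-smalls 4 (y₄ ∷ rest))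
... | result (suc k) (fsuc (fsuc fzero)) refl =
  skolem-oddPart₆ k a b+a≡ record { base = base ; ys = ys ; count = count ; uses = uses ; parity = parity
                                  ; flexible = f₁ ∷ f₂ ∷ f₃ ∷ f₄ ∷ gs }

-- Skolem sequences from concentric pairs

step : ℕ → ℕ → List ℕ
step d zero    = []
step d (suc n) = d ∷ step (2 + d) n

step-++ : ∀ d m n → step d (m + n) ≡ step d m ++ step (m + m + d) n
step-++ d zero    n = refl
step-++ d (suc m) n = cong (d ∷_) (≡.trans (step-++ (2 + d) m n)
  (cong (λ e → step (2 + d) m ++ step e n) (shuffle m d)))
  where
  shuffle : ∀ m d → m + m + (2 + d) ≡ suc m + suc m + d
  shuffle = ℕRing.solve-∀

-- Once the first number is removed, the two progressions change roles and their lengths differ by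
-- one; hence the mutual induction.
interleave : ∀ a n → step a n ++ step (suc a) n ↭ seg a (n + n)
interleave′ : ∀ a n → step a (suc n) ++ step (suc a) n ↭ seg a (suc (n + n))

interleave a zero    = ↭-refl
interleave a (suc n) = ↭-trans
  (prep a (↭-trans (++-comm (step (2 + a) n) (step (suc a) (suc n))) (interleave′ (suc a) n)))
  (↭-reflexive (cong (λ k → seg a (suc k)) (sym (ℕ.+-suc n n))))
interleave′ a n =
  prep a (↭-trans (++-comm (step (2 + a) n) (step (suc a) n)) (interleave (suc a) n))

expand : (ℕ → ℕ → List ℕ) → List (ℕ × ℕ) → List ℕ
expand f = concatMap (uncurry f)

expand-↭ : ∀ f {is js} → is ↭ js → expand f is ↭ expand f js
expand-↭ f p = concat-↭ (map⁺ (uncurry f) p)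

expand-++ : ∀ f is js → expand f (is ++ js) ≡ expand f is ++ expand f js
expand-++ f = concatMap-++ (uncurry f)

lengths : List (ℕ × ℕ) → ℕ
lengths = sum ∘ map proj₂

-- Adjacency is a conjunction of equations between end points, so that each concrete tiling reduces
-- to ring identities.
Tiles : ℕ → List (ℕ × ℕ) → Set
Tiles a []             = ⊤
Tiles a ((b , n) ∷ is) = a ≡ b × Tiles (b + n) is

StepTiles : ℕ → List (ℕ × ℕ) → Set
StepTiles a []             = ⊤
StepTiles a ((b , n) ∷ is) = a ≡ b × StepTiles (n + n + b) is

tiles-seg : ∀ {a} is → Tiles a is → expand seg is ≡ seg a (lengths is)
tiles-seg []             _          = refl
tiles-seg ((b , n) ∷ is) (refl , t) =
  ≡.trans (cong (seg b n ++_) (tiles-seg is t)) (sym (seg-++ b n (lengths is)))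

tiles-step : ∀ {a} is → StepTiles a is → expand step is ≡ step a (lengths is)
tiles-step []             _          = refl
tiles-step ((b , n) ∷ is) (refl , t) =
  ≡.trans (cong (step b n ++_) (tiles-step is t)) (sym (step-++ b n (lengths is)))

-- nest y d n consists of n concentric pairs with differences d, d + 2, …, given
-- as (difference , lower end); the lower ends fill the interval from y on.
nest : ℕ → ℕ → ℕ → List (ℕ × ℕ)
nest y d zero    = []
nest y d (suc n) = (d , y + n) ∷ nest y (2 + d) n

nest-differences : ∀ y d n → map proj₁ (nest y d n) ≡ step d n
nest-differences y d zero    = refl
nest-differences y d (suc n) = cong (d ∷_) (nest-differences y (2 + d) n)

nest-lower : ∀ y d n → map proj₂ (nest y d n) ↭ seg y n
nest-lower y d zero    = ↭-refl
nest-lower y d (suc n) = ↭-trans (prep _ (nest-lower y (2 + d) n)) (↭-sym (seg-suc y n))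

upper : ℕ × ℕ → ℕ
upper (d , y) = y + d

nest-upper : ∀ y d n → map upper (nest y (suc d) n) ≡ seg (y + n + d) n
nest-upper y d zero    = refl
nest-upper y d (suc n) = cong₂ _∷_ (first y n d) (≡.trans (nest-upper y (2 + d) n) (cong (λ a → seg a n) (rest y n d)))
  where
  first : ∀ y n d → y + n + suc d ≡ y + suc n + d
  first = ℕRing.solve-∀
  rest : ∀ y n d → y + n + (2 + d) ≡ suc (y + suc n + d)
  rest = ℕRing.solve-∀

-- (y , d , n) encodes nest y (suc d) n.
Nests : Set
Nests = List (ℕ × ℕ × ℕ)

pairsOf : Nests → List (ℕ × ℕ)
pairsOf = concatMap λ { (y , d , n) → nest y (suc d) n }

-- The number `d` counts the places enclosed by the innermost pair of a nest, so the upper ends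
-- begin at `y + n + d` and no subtraction occurs.
differences lowers uppers : Nests → List (ℕ × ℕ)
differences = map λ { (y , d , n) → suc d , n }
lowers      = map λ { (y , d , n) → y , n }
uppers      = map λ { (y , d , n) → y + n + d , n }

pairs-differences : ∀ ns → map proj₁ (pairsOf ns) ≡ expand step (differences ns)
pairs-differences [] = refl
pairs-differences ((y , d , n) ∷ ns) = ≡.trans (map-++ proj₁ (nest y (suc d) n) (pairsOf ns))
  (cong₂ _++_ (nest-differences y (suc d) n) (pairs-differences ns))

pairs-lower : ∀ ns → map proj₂ (pairsOf ns) ↭ expand seg (lowers ns)
pairs-lower [] = ↭-refl
pairs-lower ((y , d , n) ∷ ns) = ↭-trans (↭-reflexive (map-++ proj₂ (nest y (suc d) n) (pairsOf ns)))
  (++⁺ (nest-lower y (suc d) n) (pairs-lower ns))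

pairs-upper : ∀ ns → map upper (pairsOf ns) ≡ expand seg (uppers ns)
pairs-upper [] = refl
pairs-upper ((y , d , n) ∷ ns) = ≡.trans (map-++ upper (nest y (suc d) n) (pairsOf ns))
  (cong₂ _++_ (nest-upper y d n) (pairs-upper ns))

pairLabels : ℕ × ℕ → List ℕ
pairLabels (d , y) = d ∷ y ∷ y + d ∷ []

pairLabels-↭ : ∀ ps → concatMap pairLabels ps ↭ map proj₁ ps ++ map proj₂ ps ++ map upper ps
pairLabels-↭ []             = ↭-refl
pairLabels-↭ ((d , y) ∷ ps) = prep d (begin
  y ∷ y + d ∷ concatMap pairLabels ps         ↭⟨ prep y (prep (y + d) (pairLabels-↭ ps)) ⟩
  y ∷ y + d ∷ ds ++ ls ++ us                  ↭⟨ prep y (prep (y + d) (shifts ds ls)) ⟩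
  y ∷ y + d ∷ ls ++ ds ++ us                  ↭⟨ prep y (shift (y + d) ls (ds ++ us)) ⟨
  y ∷ ls ++ y + d ∷ ds ++ us                  ↭⟨ prep y (++⁺ˡ ls (shift (y + d) ds us)) ⟨
  (y ∷ ls) ++ ds ++ y + d ∷ us                ↭⟨ shifts (y ∷ ls) ds ⟩
  ds ++ (y ∷ ls) ++ y + d ∷ us                ∎)
  where
  open PermutationReasoning
  ds ls us : List ℕ
  ds = map proj₁ ps
  ls = map proj₂ ps
  us = map upper ps

plain-labels : ∀ s ps → map proj₁ ps ≡ seg s (length ps) →
  concatMap tripleLabels (plain s (map proj₂ ps)) ≡ concatMap pairLabels ps
plain-labels s []             eq = refl
plain-labels s ((d , y) ∷ ps) eq with refl , eq′ ← ∷-injective eq =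
  cong (λ l → s ∷ y ∷ y + s ∷ l) (plain-labels (suc s) ps eq′)

seg-length : ∀ a n → length (seg a n) ≡ n
seg-length a zero    = refl
seg-length a (suc n) = cong suc (seg-length (suc a) n)

-- The nests list the differences in an order of their own, whereas `plain` expects 1, ..., q.
sort-pairs : ∀ q ps {L} → map proj₁ ps ↭ seg 1 q → concatMap pairLabels ps ↭ L →
  ∃ λ ys → length ys ≡ q × concatMap tripleLabels (plain 1 ys) ↭ L
sort-pairs q ps p labels with ps′ , eq , r ← ↭-map-inv proj₁ p = map proj₂ ps′ ,
  ≡.trans (length-map proj₂ ps′) count ,
  ↭-trans (↭-reflexive (plain-labels 1 ps′ (≡.trans (sym eq) (cong (seg 1) (sym count)))))
    (↭-trans (concat-↭ (map⁺ pairLabels (↭-sym r))) labels)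
  where
  count : length ps′ ≡ q
  count = ≡.trans (sym (length-map proj₁ ps′)) (≡.trans (cong length (sym eq)) (seg-length 1 q))

descend-↭ : ∀ n → seg 1 n ↭ descend n
descend-↭ zero    = ↭-refl
descend-↭ (suc n) = ↭-trans (seg-suc 1 n) (prep (suc n) (descend-↭ n))

extra : State → List ℕ
extra (full n) = []
extra (gap n)  = 2 + n ∷ []

used-↭ : ∀ st → seg 1 (frontier st) ++ extra st ↭ used st
used-↭ (full n) = ↭-trans (↭-reflexive (++-identityʳ _)) (descend-↭ n)
used-↭ (gap n)  = ↭-trans (++-comm (seg 1 n) _) (prep (2 + n) (descend-↭ n))

top : State → ℕ
top (full n) = n
top (gap n)  = 2 + n

descend-≤ : ∀ n → All (_≤ n) (descend n)
descend-≤ zero    = []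
descend-≤ (suc n) = ℕ.≤-refl ∷ All.map ℕ.m≤n⇒m≤1+n (descend-≤ n)

used-≤ : ∀ st → All (_≤ top st) (used st)
used-≤ (full n) = descend-≤ n
used-≤ (gap n)  = ℕ.≤-refl ∷ All.map (λ le → ℕ.m≤n⇒m≤1+n (ℕ.m≤n⇒m≤1+n le)) (descend-≤ n)

frontier≤top : ∀ st → frontier st ≤ top st
frontier≤top (full n) = ℕ.≤-refl
frontier≤top (gap n)  = ℕ.m≤n+m n 2

even≢odd : ∀ m n → m + m ≢ suc (n + n)
even≢odd (suc m) n eq = even≢odd n m (sym (ℕ.suc-injective (≡.trans (cong suc (sym (ℕ.+-suc m m))) eq)))

3*m≤sum-seg : ∀ a m → m * 3 ≤ sum (seg (3 + a) m)
3*m≤sum-seg a zero    = z≤n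
3*m≤sum-seg a (suc m) = ℕ.+-mono-≤ (ℕ.m≤m+n 3 a) (3*m≤sum-seg (suc a) m)

-- With q = 7 + m no label exceeds 3q + 1 = 22 + 3m, and 4 + R (3 + m) is at least 4 + 5 + 6 + 7 +
-- 3m, the same number. So whichever member of the pair is even will do.
flexible-generic : ∀ m {N y} k → N ≤ 22 + m * 3 → y + suc (k + k) ≤ 22 + m * 3 →
  Flexible (3 + m) N y (suc (k + k))
flexible-generic m {N} {y} k N≤ y≤ with half y
... | inj₁ (j , refl) = record
  { k = j ; k∈ = here refl
  ; upper = ℕ.≤-trans small (ℕ.m≤n⇒m≤o+n 1 (ℕ.m≤m+n _ N))
  ; lower = ℕ.≤-trans N≤ (ℕ.≤-trans large (ℕ.m≤m+n _ _))
  ; tight = λ _ _ → small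
  }
  where
  large : 22 + m * 3 ≤ 4 + R (3 + m)
  large = ℕ.+-monoʳ-≤ 22 (3*m≤sum-seg 5 m)
  small : j + j ≤ 5 + R (3 + m)
  small = ℕ.≤-trans (ℕ.≤-trans (ℕ.m≤m+n _ _) y≤) (ℕ.m≤n⇒m≤1+n large)
... | inj₂ (j , refl) = record
  { k = suc (j + k) ; k∈ = there (here (sum≡ j k))
  ; upper = ℕ.≤-trans small (ℕ.m≤n⇒m≤o+n 1 (ℕ.m≤m+n _ N))
  ; lower = ℕ.≤-trans N≤ (ℕ.≤-trans large (ℕ.m≤m+n _ _))
  ; tight = λ _ _ → small
  }
  where
  sum≡ : ∀ j k → suc (j + k) + suc (j + k) ≡ suc (j + j) + suc (k + k)
  sum≡ = ℕRing.solve-∀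
  large : 22 + m * 3 ≤ 4 + R (3 + m)
  large = ℕ.+-monoʳ-≤ 22 (3*m≤sum-seg 5 m)
  small : suc (j + k) + suc (j + k) ≤ 5 + R (3 + m)
  small = ℕ.≤-trans (ℕ.≤-trans (ℕ.≤-reflexive (sum≡ j k)) y≤) (ℕ.m≤n⇒m≤1+n large)

skolem-generic : ∀ m base ys → length ys ≡ 7 + m → concatMap tripleLabels (plain 1 ys) ↭ used base →
  (∃ λ w → 8 + R (3 + m) + frontier base ≡ w + w) → top base ≤ 22 + m * 3 → Skolem (3 + m)
skolem-generic m base ys count uses parity top≤ = record
  { base = base ; ys = ys ; count = count ; uses = uses ; parity = parity
  ; flexible = flexible 1 ys (All-resp-↭ (↭-sym uses) (used-≤ base))
  }
  where
  flexible : ∀ s ys → All (_≤ top base) (concatMap tripleLabels (plain s ys)) →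
    All (λ { (_ , y , d) → ∀ k → d ≡ suc (k + k) → Flexible (3 + m) (frontier base) y d }) (plain s ys)
  flexible s []       []                   = []
  flexible s (y ∷ ys) (_ ∷ _ ∷ y+s≤ ∷ les) =
    (λ { k refl → flexible-generic m k (ℕ.≤-trans (frontier≤top base) top≤) (ℕ.≤-trans y+s≤ top≤) })
    ∷ flexible (suc s) ys les

-- `is` sorts the differences into the odd and the even progression, `js` sorts the intervals of end
-- points into a tiling of the labels above 7 + m. `exs` holds the hook, the label beyond the gap.
skolem-nests : ∀ m base ns is js {odds evens ivs exs} o →
  select is (differences ns) ≡ odds ++ evens → StepTiles 1 odds → StepTiles 2 evens →
  lengths odds ≡ o × lengths evens ≡ o × o + o ≡ 7 + m
  ⊎ lengths odds ≡ suc o × lengths evens ≡ o × suc (o + o) ≡ 7 + m →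
  select js (lowers ns ++ uppers ns) ≡ ivs ++ exs →
  Tiles (8 + m) ivs → 7 + m + lengths ivs ≡ frontier base → expand seg exs ≡ extra base →
  (∃ λ w → 8 + R (3 + m) + frontier base ≡ w + w) → top base ≤ 22 + m * 3 → Skolem (3 + m)
skolem-nests m base ns is js {odds} {evens} {ivs} {exs} o ds-≡ odds-tile evens-tile counts
  ivs-≡ ivs-tile ivs-length exs-≡ parity top≤ =
  skolem-generic m base (proj₁ sorted) (proj₁ (proj₂ sorted)) (proj₂ (proj₂ sorted)) parity top≤
  where
  open PermutationReasoning
  weave : lengths odds ≡ o × lengths evens ≡ o × o + o ≡ 7 + m
        ⊎ lengths odds ≡ suc o × lengths evens ≡ o × suc (o + o) ≡ 7 + m →
    step 1 (lengths odds) ++ step 2 (lengths evens) ↭ seg 1 (7 + m)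
  weave (inj₁ (eq₁ , eq₂ , eq)) rewrite eq₁ | eq₂ =
    ↭-trans (interleave 1 o) (↭-reflexive (cong (seg 1) eq))
  weave (inj₂ (eq₁ , eq₂ , eq)) rewrite eq₁ | eq₂ =
    ↭-trans (interleave′ 1 o) (↭-reflexive (cong (seg 1) eq))
  smalls : map proj₁ (pairsOf ns) ↭ seg 1 (7 + m)
  smalls = begin
    map proj₁ (pairsOf ns)                             ≡⟨ pairs-differences ns ⟩
    expand step (differences ns)                       ↭⟨ expand-↭ step (select-↭ is (differences ns)) ⟩
    expand step (select is (differences ns))           ≡⟨ cong (expand step) ds-≡ ⟩
    expand step (odds ++ evens)                        ≡⟨ expand-++ step odds evens ⟩
    expand step odds ++ expand step evens              ≡⟨ cong₂ _++_ (tiles-step odds odds-tile) (tiles-step evens evens-tile) ⟩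
    step 1 (lengths odds) ++ step 2 (lengths evens)    ↭⟨ weave counts ⟩
    seg 1 (7 + m)                                      ∎
  labels : concatMap pairLabels (pairsOf ns) ↭ used base
  labels = begin
    concatMap pairLabels (pairsOf ns)
      ↭⟨ pairLabels-↭ (pairsOf ns) ⟩
    map proj₁ (pairsOf ns) ++ map proj₂ (pairsOf ns) ++ map upper (pairsOf ns)
      ↭⟨ ++⁺ smalls (++⁺ (pairs-lower ns) (↭-reflexive (pairs-upper ns))) ⟩
    seg 1 (7 + m) ++ expand seg (lowers ns) ++ expand seg (uppers ns)
      ≡⟨ cong (seg 1 (7 + m) ++_) (expand-++ seg (lowers ns) (uppers ns)) ⟨
    seg 1 (7 + m) ++ expand seg (lowers ns ++ uppers ns)
      ↭⟨ ++⁺ˡ (seg 1 (7 + m)) (expand-↭ seg (select-↭ js (lowers ns ++ uppers ns))) ⟩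
    seg 1 (7 + m) ++ expand seg (select js (lowers ns ++ uppers ns))
      ≡⟨ cong (λ l → seg 1 (7 + m) ++ expand seg l) ivs-≡ ⟩
    seg 1 (7 + m) ++ expand seg (ivs ++ exs)
      ≡⟨ cong (seg 1 (7 + m) ++_) (expand-++ seg ivs exs) ⟩
    seg 1 (7 + m) ++ expand seg ivs ++ expand seg exs
      ≡⟨ cong (λ l → seg 1 (7 + m) ++ l ++ expand seg exs) (tiles-seg ivs ivs-tile) ⟩
    seg 1 (7 + m) ++ seg (8 + m) (lengths ivs) ++ expand seg exs
      ≡⟨ ++-assoc (seg 1 (7 + m)) _ _ ⟨
    (seg 1 (7 + m) ++ seg (8 + m) (lengths ivs)) ++ expand seg exs
      ≡⟨ cong (_++ expand seg exs) (seg-++ 1 (7 + m) (lengths ivs)) ⟨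
    seg 1 (7 + m + lengths ivs) ++ expand seg exs
      ≡⟨ cong₂ (λ l e → seg 1 l ++ e) ivs-length exs-≡ ⟩
    seg 1 (frontier base) ++ extra base
      ↭⟨ used-↭ base ⟩
    used base ∎
  sorted : ∃ λ ys → length ys ≡ 7 + m × concatMap tripleLabels (plain 1 ys) ↭ used base
  sorted = sort-pairs (7 + m) (pairsOf ns) smalls labels

R-4+ : ∀ n → R (4 + n) ≡ R n + (n * 4 + 26)
R-4+ n = begin
  R (4 + n)                        ≡⟨ cong R (+-comm 4 n) ⟩
  sum (seg 5 (n + 4))              ≡⟨ cong sum (seg-++ 5 n 4) ⟩
  sum (seg 5 n ++ seg (5 + n) 4)   ≡⟨ sum-++ (seg 5 n) (seg (5 + n) 4) ⟩
  R n + sum (seg (5 + n) 4)        ≡⟨ cong (_+_ (R n)) (last n) ⟩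
  R n + (n * 4 + 26)               ∎
  where
  open ≡-Reasoning
  last : ∀ n → 5 + n + (6 + n + (7 + n + (8 + n + 0))) ≡ n * 4 + 26
  last = ℕRing.solve-∀

-- Four more odd stars add the even amounts 4m + 26 to `R` and 12 to the frontier.
parity-generic : ∀ r N → (∃ λ w → 8 + R r + N ≡ w + w) → ∀ k →
  ∃ λ w → 8 + R (k * 4 + r) + (k * 12 + N) ≡ w + w
parity-generic r N even zero = even
parity-generic r N even (suc k) with w , eq ← parity-generic r N even k =
  w + (((k * 4 + r) * 2) + 19) , (begin
    8 + R (4 + m) + (12 + (k * 12 + N))                ≡⟨ cong (λ x → 8 + x + (12 + (k * 12 + N))) (R-4+ m) ⟩
    8 + (R m + (m * 4 + 26)) + (12 + (k * 12 + N))     ≡⟨ shuffle (R m) m (k * 12 + N) ⟩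
    (8 + R m + (k * 12 + N)) + (m * 4 + 38)            ≡⟨ cong (_+ (m * 4 + 38)) eq ⟩
    (w + w) + (m * 4 + 38)                             ≡⟨ shuffle′ w m ⟩
    (w + (m * 2 + 19)) + (w + (m * 2 + 19))            ∎)
  where
  open ≡-Reasoning
  m : ℕ
  m = k * 4 + r
  shuffle : ∀ r m x → 8 + (r + (m * 4 + 26)) + (12 + x) ≡ (8 + r + x) + (m * 4 + 38)
  shuffle = ℕRing.solve-∀
  shuffle′ : ∀ w m → (w + w) + (m * 4 + 38) ≡ (w + (m * 2 + 19)) + (w + (m * 2 + 19))
  shuffle′ = ℕRing.solve-∀

parity-at : ∀ {n r N} k → n ≡ k * 4 + r → (∃ λ w → 8 + R r + N ≡ w + w) →
  ∃ λ w → 8 + R n + (k * 12 + N) ≡ w + w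
parity-at k refl even = parity-generic _ _ even k

-- The classical (hooked) Skolem sequences of order 4 + n: the first nest has even
-- differences, the next two have odd ones, and the single pairs fill the gaps.
-- (List constructors are qualified because the ring tactic does not resolve overloading.)
skolem-3 : ∀ k → Skolem (3 + k * 4)
skolem-3 k = skolem-nests (k * 4) (gap (k * 12 + 20))
  ( (k * 4 + 8 , 1 , k * 2 + 3)
  ∷ (k * 8 + 15 , k * 2 + 4 , k + 1)
  ∷ (k * 9 + 18 , 2 , k)
  ∷ (k * 10 + 19 , k * 2 + 2 , 1)
  ∷ (k * 9 + 16 , 0 , 1)
  ∷ (k * 6 + 11 , k * 4 + 6 , 1) ∷ [])
  (4 ∷ 2 ∷ 2 ∷ 1 ∷ 1 ∷ 0 ∷ [])
  (0 ∷ 4 ∷ 4 ∷ 0 ∷ 2 ∷ 5 ∷ 0 ∷ 4 ∷ 0 ∷ 1 ∷ 0 ∷ 0 ∷ [])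
  {odds = (1 , 1) ∷ (3 , k) ∷ (suc (k * 2 + 2) , 1) ∷ (suc (k * 2 + 4) , k + 1) ∷
           (suc (k * 4 + 6) , 1) ∷ []}
  {evens = (2 , k * 2 + 3) ∷ []}
  {ivs = (k * 4 + 8 , k * 2 + 3) ∷ (k * 6 + 11 , 1) ∷ (k * 4 + 8 + (k * 2 + 3) + 1 , k * 2 + 3) ∷
          (k * 8 + 15 , k + 1) ∷ (k * 9 + 16 , 1) ∷ (k * 9 + 16 + 1 + 0 , 1) ∷ (k * 9 + 18 , k) ∷
          (k * 6 + 11 + 1 + (k * 4 + 6) , 1) ∷ (k * 10 + 19 , 1) ∷ (k * 9 + 18 + k + 2 , k) ∷
          (k * 8 + 15 + (k + 1) + (k * 2 + 4) , k + 1) ∷ []}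
  {exs = (k * 10 + 19 + 1 + (k * 2 + 2) , 1) ∷ []}
  (k * 2 + 3)
  refl (ℕRing.solve (k List.∷ List.[]) , ℕRing.solve (k List.∷ List.[]) , ℕRing.solve (k List.∷ List.[]) ,
    ℕRing.solve (k List.∷ List.[]) , ℕRing.solve (k List.∷ List.[]) , tt) (ℕRing.solve (k List.∷ List.[]) ,
    tt)
  (inj₂ (odds k , evens k , ℕRing.solve (k List.∷ List.[])))
  refl
  ( ℕRing.solve (k List.∷ List.[]) , ℕRing.solve (k List.∷ List.[]) , ℕRing.solve (k List.∷ List.[]) ,
    ℕRing.solve (k List.∷ List.[]) , ℕRing.solve (k List.∷ List.[]) , ℕRing.solve (k List.∷ List.[])
  , ℕRing.solve (k List.∷ List.[]) , ℕRing.solve (k List.∷ List.[]) , ℕRing.solve (k List.∷ List.[]) ,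
    ℕRing.solve (k List.∷ List.[]) , ℕRing.solve (k List.∷ List.[]) , tt)
  (ivs k)
  (cong (_∷ []) (ℕRing.solve (k List.∷ List.[])))
  (parity-at k (+-comm 3 (k * 4)) (23 , refl))
  (ℕ.≤-reflexive (bound k))
  where
  odds : ∀ k → 1 + (k + (1 + ((k + 1) + (1 + 0)))) ≡ suc (k * 2 + 3)
  odds = ℕRing.solve-∀
  evens : ∀ k → (k * 2 + 3) + 0 ≡ k * 2 + 3
  evens = ℕRing.solve-∀
  ivs : ∀ k → 7 + (k * 4) + ((k * 2 + 3) + (1 + ((k * 2 + 3) + ((k + 1) + (1 + (1 + (k + (1 + (1 + (k + ((k + 1) + 0))))))))))) ≡ k * 12 + 20
  ivs = ℕRing.solve-∀
  bound : ∀ k → 2 + (k * 12 + 20) ≡ 22 + (k * 4) * 3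
  bound = ℕRing.solve-∀

-- Every triple s, y, y + s has an even sum, so the labels can be 1, ..., 3q only for q ≡ 0, 1 (mod
-- 4). Hence `full` here and in `skolem-5`, but `gap` in `skolem-3` and `skolem-6`.
skolem-4 : ∀ k → Skolem (4 + k * 4)
skolem-4 k = skolem-nests (1 + k * 4) (full (k * 12 + 24))
  ( (k * 8 + 16 , 1 , k * 2 + 4)
  ∷ (k * 4 + 9 , k * 2 + 6 , k)
  ∷ (k * 5 + 12 , 2 , k)
  ∷ (k * 5 + 9 , k * 2 + 4 , 1)
  ∷ (k * 5 + 10 , 0 , 1)
  ∷ (k * 6 + 12 , k * 2 + 2 , 1)
  ∷ (k * 6 + 13 , k * 4 + 6 , 1) ∷ [])
  (4 ∷ 2 ∷ 3 ∷ 2 ∷ 1 ∷ 1 ∷ 0 ∷ [])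
  (1 ∷ 2 ∷ 2 ∷ 8 ∷ 1 ∷ 1 ∷ 1 ∷ 3 ∷ 3 ∷ 2 ∷ 2 ∷ 0 ∷ 1 ∷ 0 ∷ [])
  {odds = (1 , 1) ∷ (3 , k) ∷ (suc (k * 2 + 2) , 1) ∷ (suc (k * 2 + 4) , 1) ∷ (suc (k * 2 + 6) , k) ∷
           (suc (k * 4 + 6) , 1) ∷ []}
  {evens = (2 , k * 2 + 4) ∷ []}
  {ivs = (k * 4 + 9 , k) ∷ (k * 5 + 9 , 1) ∷ (k * 5 + 10 , 1) ∷ (k * 5 + 10 + 1 + 0 , 1) ∷
          (k * 5 + 12 , k) ∷ (k * 6 + 12 , 1) ∷ (k * 6 + 13 , 1) ∷ (k * 5 + 12 + k + 2 , k) ∷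
          (k * 5 + 9 + 1 + (k * 2 + 4) , 1) ∷ (k * 4 + 9 + k + (k * 2 + 6) , k) ∷
          (k * 6 + 12 + 1 + (k * 2 + 2) , 1) ∷ (k * 8 + 16 , k * 2 + 4) ∷
          (k * 6 + 13 + 1 + (k * 4 + 6) , 1) ∷ (k * 8 + 16 + (k * 2 + 4) + 1 , k * 2 + 4) ∷ []}
  {exs = []}
  (k * 2 + 4)
  refl (ℕRing.solve (k List.∷ List.[]) , ℕRing.solve (k List.∷ List.[]) , ℕRing.solve (k List.∷ List.[]) ,
    ℕRing.solve (k List.∷ List.[]) , ℕRing.solve (k List.∷ List.[]) , ℕRing.solve (k List.∷ List.[]) ,
    tt) (ℕRing.solve (k List.∷ List.[]) , tt)
  (inj₁ (odds k , evens k , ℕRing.solve (k List.∷ List.[])))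
  refl
  ( ℕRing.solve (k List.∷ List.[]) , ℕRing.solve (k List.∷ List.[]) , ℕRing.solve (k List.∷ List.[]) ,
    ℕRing.solve (k List.∷ List.[]) , ℕRing.solve (k List.∷ List.[]) , ℕRing.solve (k List.∷ List.[])
  , ℕRing.solve (k List.∷ List.[]) , ℕRing.solve (k List.∷ List.[]) , ℕRing.solve (k List.∷ List.[]) ,
    ℕRing.solve (k List.∷ List.[]) , ℕRing.solve (k List.∷ List.[]) , ℕRing.solve (k List.∷ List.[]) ,
    ℕRing.solve (k List.∷ List.[]) , ℕRing.solve (k List.∷ List.[]) , tt)
  (ivs k)
  refl
  (parity-at k (+-comm 4 (k * 4)) (29 , refl))
  (ℕ.m≤n⇒m≤1+n (ℕ.≤-reflexive (bound k)))
  where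
  odds : ∀ k → 1 + (k + (1 + (1 + (k + (1 + 0))))) ≡ k * 2 + 4
  odds = ℕRing.solve-∀
  evens : ∀ k → (k * 2 + 4) + 0 ≡ k * 2 + 4
  evens = ℕRing.solve-∀
  ivs : ∀ k → 7 + (1 + k * 4) + (k + (1 + (1 + (1 + (k + (1 + (1 + (k + (1 + (k + (1 + ((k * 2 + 4) + (1 + ((k * 2 + 4) + 0)))))))))))))) ≡ k * 12 + 24
  ivs = ℕRing.solve-∀
  bound : ∀ k → (k * 12 + 24) ≡ 21 + (1 + k * 4) * 3
  bound = ℕRing.solve-∀

skolem-5 : ∀ k → Skolem (5 + k * 4)
skolem-5 k = skolem-nests (2 + k * 4) (full (k * 12 + 27))
  ( (k * 8 + 19 , 1 , k * 2 + 4)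
  ∷ (k * 4 + 10 , k * 2 + 4 , k + 2)
  ∷ (k * 5 + 14 , 2 , k)
  ∷ (k * 5 + 12 , 0 , 1)
  ∷ (k * 6 + 14 , k * 4 + 8 , 1)
  ∷ (k * 6 + 15 , k * 2 + 2 , 1) ∷ [])
  (3 ∷ 2 ∷ 3 ∷ 1 ∷ 1 ∷ 0 ∷ [])
  (1 ∷ 2 ∷ 7 ∷ 1 ∷ 1 ∷ 1 ∷ 3 ∷ 2 ∷ 3 ∷ 0 ∷ 1 ∷ 0 ∷ [])
  {odds = (1 , 1) ∷ (3 , k) ∷ (suc (k * 2 + 2) , 1) ∷ (suc (k * 2 + 4) , k + 2) ∷
           (suc (k * 4 + 8) , 1) ∷ []}
  {evens = (2 , k * 2 + 4) ∷ []}
  {ivs = (k * 4 + 10 , k + 2) ∷ (k * 5 + 12 , 1) ∷ (k * 5 + 12 + 1 + 0 , 1) ∷ (k * 5 + 14 , k) ∷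
          (k * 6 + 14 , 1) ∷ (k * 6 + 15 , 1) ∷ (k * 5 + 14 + k + 2 , k) ∷
          (k * 4 + 10 + (k + 2) + (k * 2 + 4) , k + 2) ∷ (k * 6 + 15 + 1 + (k * 2 + 2) , 1) ∷
          (k * 8 + 19 , k * 2 + 4) ∷ (k * 6 + 14 + 1 + (k * 4 + 8) , 1) ∷
          (k * 8 + 19 + (k * 2 + 4) + 1 , k * 2 + 4) ∷ []}
  {exs = []}
  (k * 2 + 4)
  refl (ℕRing.solve (k List.∷ List.[]) , ℕRing.solve (k List.∷ List.[]) , ℕRing.solve (k List.∷ List.[]) ,
    ℕRing.solve (k List.∷ List.[]) , ℕRing.solve (k List.∷ List.[]) , tt) (ℕRing.solve (k List.∷ List.[]) ,
    tt)
  (inj₂ (odds k , evens k , ℕRing.solve (k List.∷ List.[])))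
  refl
  ( ℕRing.solve (k List.∷ List.[]) , ℕRing.solve (k List.∷ List.[]) , ℕRing.solve (k List.∷ List.[]) ,
    ℕRing.solve (k List.∷ List.[]) , ℕRing.solve (k List.∷ List.[]) , ℕRing.solve (k List.∷ List.[])
  , ℕRing.solve (k List.∷ List.[]) , ℕRing.solve (k List.∷ List.[]) , ℕRing.solve (k List.∷ List.[]) ,
    ℕRing.solve (k List.∷ List.[]) , ℕRing.solve (k List.∷ List.[]) , ℕRing.solve (k List.∷ List.[]) ,
    tt)
  (ivs k)
  refl
  (parity-at k (+-comm 5 (k * 4)) (35 , refl))
  (ℕ.m≤n⇒m≤1+n (ℕ.≤-reflexive (bound k)))
  where
  odds : ∀ k → 1 + (k + (1 + ((k + 2) + (1 + 0)))) ≡ suc (k * 2 + 4)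
  odds = ℕRing.solve-∀
  evens : ∀ k → (k * 2 + 4) + 0 ≡ k * 2 + 4
  evens = ℕRing.solve-∀
  ivs : ∀ k → 7 + (2 + k * 4) + ((k + 2) + (1 + (1 + (k + (1 + (1 + (k + ((k + 2) + (1 + ((k * 2 + 4) + (1 + ((k * 2 + 4) + 0)))))))))))) ≡ k * 12 + 27
  ivs = ℕRing.solve-∀
  bound : ∀ k → (k * 12 + 27) ≡ 21 + (2 + k * 4) * 3
  bound = ℕRing.solve-∀

-- The largest difference q = 10 + 4k is even but lies outside the first nest; the upper end of its
-- single pair is the hook 3q + 1.
skolem-6 : ∀ k → Skolem (6 + k * 4)
skolem-6 k = skolem-nests (3 + k * 4) (gap (k * 12 + 29))
  ( (k * 4 + 11 , 1 , k * 2 + 4)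
  ∷ (k * 8 + 22 , k * 2 + 6 , k + 1)
  ∷ (k * 9 + 23 , 2 , k + 1)
  ∷ (k * 6 + 15 , k * 4 + 8 , 1)
  ∷ (k * 8 + 20 , k * 2 + 4 , 1)
  ∷ (k * 8 + 21 , k * 4 + 9 , 1)
  ∷ (k * 11 + 27 , 0 , 1) ∷ [])
  (6 ∷ 2 ∷ 3 ∷ 1 ∷ 1 ∷ 0 ∷ 0 ∷ [])
  (0 ∷ 2 ∷ 5 ∷ 2 ∷ 2 ∷ 0 ∷ 0 ∷ 3 ∷ 3 ∷ 2 ∷ 0 ∷ 2 ∷ 0 ∷ 0 ∷ [])
  {odds = (1 , 1) ∷ (3 , k + 1) ∷ (suc (k * 2 + 4) , 1) ∷ (suc (k * 2 + 6) , k + 1) ∷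
           (suc (k * 4 + 8) , 1) ∷ []}
  {evens = (2 , k * 2 + 4) ∷ (suc (k * 4 + 9) , 1) ∷ []}
  {ivs = (k * 4 + 11 , k * 2 + 4) ∷ (k * 6 + 15 , 1) ∷ (k * 4 + 11 + (k * 2 + 4) + 1 , k * 2 + 4) ∷
          (k * 8 + 20 , 1) ∷ (k * 8 + 21 , 1) ∷ (k * 8 + 22 , k + 1) ∷ (k * 9 + 23 , k + 1) ∷
          (k * 6 + 15 + 1 + (k * 4 + 8) , 1) ∷ (k * 8 + 20 + 1 + (k * 2 + 4) , 1) ∷
          (k * 9 + 23 + (k + 1) + 2 , k + 1) ∷ (k * 11 + 27 , 1) ∷ (k * 11 + 27 + 1 + 0 , 1) ∷
          (k * 8 + 22 + (k + 1) + (k * 2 + 6) , k + 1) ∷ []}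
  {exs = (k * 8 + 21 + 1 + (k * 4 + 9) , 1) ∷ []}
  (k * 2 + 5)
  refl (ℕRing.solve (k List.∷ List.[]) , ℕRing.solve (k List.∷ List.[]) , ℕRing.solve (k List.∷ List.[]) ,
    ℕRing.solve (k List.∷ List.[]) , ℕRing.solve (k List.∷ List.[]) , tt) (ℕRing.solve (k List.∷ List.[]) ,
    ℕRing.solve (k List.∷ List.[]) , tt)
  (inj₁ (odds k , evens k , ℕRing.solve (k List.∷ List.[])))
  refl
  ( ℕRing.solve (k List.∷ List.[]) , ℕRing.solve (k List.∷ List.[]) , ℕRing.solve (k List.∷ List.[]) ,
    ℕRing.solve (k List.∷ List.[]) , ℕRing.solve (k List.∷ List.[]) , ℕRing.solve (k List.∷ List.[])
  , ℕRing.solve (k List.∷ List.[]) , ℕRing.solve (k List.∷ List.[]) , ℕRing.solve (k List.∷ List.[]) ,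
    ℕRing.solve (k List.∷ List.[]) , ℕRing.solve (k List.∷ List.[]) , ℕRing.solve (k List.∷ List.[]) ,
    ℕRing.solve (k List.∷ List.[]) , tt)
  (ivs k)
  (cong (_∷ []) (ℕRing.solve (k List.∷ List.[])))
  (parity-at k (+-comm 6 (k * 4)) (41 , refl))
  (ℕ.≤-reflexive (bound k))
  where
  odds : ∀ k → 1 + ((k + 1) + (1 + ((k + 1) + (1 + 0)))) ≡ k * 2 + 5
  odds = ℕRing.solve-∀
  evens : ∀ k → (k * 2 + 4) + (1 + 0) ≡ k * 2 + 5
  evens = ℕRing.solve-∀
  ivs : ∀ k → 7 + (3 + k * 4) + ((k * 2 + 4) + (1 + ((k * 2 + 4) + (1 + (1 + ((k + 1) + ((k + 1) + (1 + (1 + ((k + 1) + (1 + (1 + ((k + 1) + 0))))))))))))) ≡ k * 12 + 29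
  ivs = ℕRing.solve-∀
  bound : ∀ k → 2 + (k * 12 + 29) ≡ 22 + (3 + k * 4) * 3
  bound = ℕRing.solve-∀

-- The estimate in `flexible-generic` fails for the orders 4, 5 and 6, so there the even labels are
-- checked individually.
skolem-0 : Skolem 0
skolem-0 = record
  { base     = full 12
  ; ys       = 11 ∷ 6 ∷ 7 ∷ 5 ∷ []
  ; count    = refl
  ; uses     = select-↭ (2 ∷ 1 ∷ 6 ∷ 8 ∷ 3 ∷ 4 ∷ 2 ∷ 4 ∷ 3 ∷ 2 ∷ 1 ∷ 0 ∷ []) _
  ; parity   = 10 , refl
  ; flexible =
      (λ _ _ → record { k = 6 ; k∈ = there (here refl) ; upper = ℕ.≤ᵇ⇒≤ _ _ tt ; lower = ℕ.≤ᵇ⇒≤ _ _ tt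
                      -- The label 12 exceeds 5 + R 0, but 7 + R 0 = 7 is odd and the premise fails.
                      ; tight = λ w eq → contradiction (sym eq) (even≢odd w 3) }) ∷
      (λ k eq → contradiction eq (even≢odd 1 k)) ∷
      (λ _ _ → record { k = 5 ; k∈ = there (here refl) ; upper = ℕ.≤ᵇ⇒≤ _ _ tt ; lower = ℕ.≤ᵇ⇒≤ _ _ tt
                      ; tight = λ w eq → contradiction (sym eq) (even≢odd w 3) }) ∷
      (λ k eq → contradiction eq (even≢odd 2 k)) ∷ []
  }

skolem-1 : Skolem 1
skolem-1 = record
  { base     = full 15
  ; ys       = 6 ∷ 12 ∷ 8 ∷ 9 ∷ 10 ∷ []
  ; count    = refl
  ; uses     = select-↭ (14 ∷ 5 ∷ 10 ∷ 4 ∷ 6 ∷ 9 ∷ 7 ∷ 5 ∷ 2 ∷ 1 ∷ 4 ∷ 3 ∷ 2 ∷ 1 ∷ 0 ∷ []) _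
  ; parity   = 14 , refl
  ; flexible =
      (λ _ _ → record { k = 3 ; k∈ = here refl ; upper = ℕ.≤ᵇ⇒≤ _ _ tt ; lower = ℕ.≤ᵇ⇒≤ _ _ tt
                      ; tight = λ _ _ → ℕ.≤ᵇ⇒≤ _ _ tt }) ∷
      (λ k eq → contradiction eq (even≢odd 1 k)) ∷
      (λ _ _ → record { k = 4 ; k∈ = here refl ; upper = ℕ.≤ᵇ⇒≤ _ _ tt ; lower = ℕ.≤ᵇ⇒≤ _ _ tt
                      ; tight = λ _ _ → ℕ.≤ᵇ⇒≤ _ _ tt }) ∷
      (λ k eq → contradiction eq (even≢odd 2 k)) ∷
      (λ _ _ → record { k = 5 ; k∈ = here refl ; upper = ℕ.≤ᵇ⇒≤ _ _ tt ; lower = ℕ.≤ᵇ⇒≤ _ _ tt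
                      ; tight = λ _ _ → ℕ.≤ᵇ⇒≤ _ _ tt }) ∷ []
  }

skolem-2 : Skolem 2
skolem-2 = record
  { base     = gap 17
  ; ys       = 10 ∷ 15 ∷ 16 ∷ 8 ∷ 9 ∷ 7 ∷ []
  ; count    = refl
  ; uses     = select-↭ (8 ∷ 5 ∷ 6 ∷ 4 ∷ 10 ∷ 12 ∷ 7 ∷ 2 ∷ 1 ∷ 6 ∷ 4 ∷ 6 ∷ 5 ∷ 4 ∷ 3 ∷ 2 ∷ 1 ∷ 0 ∷ []) _
  ; parity   = 18 , refl
  ; flexible =
      (λ _ _ → record { k = 5 ; k∈ = here refl ; upper = ℕ.≤ᵇ⇒≤ _ _ tt ; lower = ℕ.≤ᵇ⇒≤ _ _ tt
                      ; tight = λ _ _ → ℕ.≤ᵇ⇒≤ _ _ tt }) ∷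
      (λ k eq → contradiction eq (even≢odd 1 k)) ∷
      (λ _ _ → record { k = 8 ; k∈ = here refl ; upper = ℕ.≤ᵇ⇒≤ _ _ tt ; lower = ℕ.≤ᵇ⇒≤ _ _ tt
                      ; tight = λ _ _ → ℕ.≤ᵇ⇒≤ _ _ tt }) ∷
      (λ k eq → contradiction eq (even≢odd 2 k)) ∷
      (λ _ _ → record { k = 7 ; k∈ = there (here refl) ; upper = ℕ.≤ᵇ⇒≤ _ _ tt ; lower = ℕ.≤ᵇ⇒≤ _ _ tt
                      ; tight = λ _ _ → ℕ.≤ᵇ⇒≤ _ _ tt }) ∷
      (λ k eq → contradiction eq (even≢odd 3 k)) ∷ []
  }

skolem : ∀ n → Skolem n
skolem 0 = skolem-0
skolem 1 = skolem-1
skolem 2 = skolem-2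
skolem (suc (suc (suc n))) with n divMod 4
... | result k fzero                refl = skolem-3 k
... | result k (fsuc fzero)           refl = skolem-4 k
... | result k (fsuc (fsuc fzero))      refl = skolem-5 k
... | result k (fsuc (fsuc (fsuc fzero))) refl = skolem-6 k

-- At most three odd stars

module _ where
  private
    pattern x∈ = here refl
    pattern y∈ = there (here refl)
    pattern z∈ = there (there (here refl))

  -- The heads 1, 2, 3 reach neither 4 nor 6. The sum -3 is enough: next to one even star the center
  -- has degree 2, and three or more even stars attain 3 by `level`.
  oddPart-1-0 : OddPart 1 0
  oddPart-1-0 = record
    { base     = full 3
    ; triples  = (1 , 2 , 1) ∷ []
    ; uses     = select-↭ (2 ∷ 1 ∷ 0 ∷ []) _
    ; finishes = finishes₁ 0 2 [] refl 2
    ; small    = inj₁ (cons (+ 1) x∈ [])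
    ; none     = inj₁ (s≤s z≤n , _ , cons (+ 1) x∈ [])
    ; large    = inj₁ (ℕ.≤-refl , cons (- + 3) z∈ [])
    }

  oddPart-0-1 : OddPart 0 1
  oddPart-0-1 = record
    { OddPart oddPart-1-0
    ; finishes = finishes₀ 0 1 (2 ∷ []) refl
    ; none     = inj₁ (s≤s z≤n , _ , cons (+ 1) x∈ [])
    ; large    = inj₁ (ℕ.≤-refl , cons (- + 3) z∈ [])
    }

  oddPart-0-2 : OddPart 0 2
  oddPart-0-2 = record
    { base     = gap 5
    ; triples  = (1 , 3 , 1) ∷ (2 , 5 , 2) ∷ []
    ; uses     = select-↭ (5 ∷ 4 ∷ 2 ∷ 1 ∷ 1 ∷ 0 ∷ []) _
    ; finishes = finishes₀ 0 1 (3 ∷ 5 ∷ []) refl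
    ; small    = inj₁ (cons (- + 1) x∈ (cons (+ 2) x∈ []))
    ; none     = inj₁ (ℕ.≤-refl , _ , cons (- + 1) x∈ (cons (+ 2) x∈ []))
    ; large    = inj₂ (inj₁ (cons (- + 4) z∈ (cons (- + 2) x∈ [])))
    }

  oddPart-1-1 : OddPart 1 1
  oddPart-1-1 = record { OddPart oddPart-0-2 ; finishes = finishes₁ 0 2 (5 ∷ []) refl 3 }

  -- No head among 1, 5, 7 and head among 2, 3, 4 give the sum ±6, so 8 = 5 + 3 is used against
  -- `high`.
  oddPart-2-0 : OddPart 2 0
  oddPart-2-0 = record
    { base     = gap 5
    ; triples  = (1 , 5 , 2) ∷ (2 , 3 , 1) ∷ []
    ; uses     = select-↭ (2 ∷ 1 ∷ 3 ∷ 2 ∷ 1 ∷ 0 ∷ []) _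
    ; finishes = finishes₂ 0 3 [] refl 3 5
    ; small    = inj₁ (cons (- + 1) x∈ (cons (+ 2) x∈ []))
    ; none     = inj₁ (ℕ.≤-refl , _ , cons (- + 1) x∈ (cons (+ 2) x∈ []))
    ; large    = inj₂ (inj₂ (cons (- + 5) y∈ (cons (- + 3) y∈ [])))
    }

  oddPart-0-3 : OddPart 0 3
  oddPart-0-3 = record
    { base     = gap 8
    ; triples  = (1 , 4 , 1) ∷ (2 , 6 , 2) ∷ (3 , 7 , 3) ∷ []
    ; uses     = select-↭ (8 ∷ 5 ∷ 6 ∷ 4 ∷ 2 ∷ 1 ∷ 2 ∷ 1 ∷ 0 ∷ []) _
    ; finishes = finishes₀ 0 1 (4 ∷ 6 ∷ 7 ∷ []) refl
    ; small    = inj₂ (cons (+ 1) x∈ (cons (- + 2) x∈ (cons (+ 3) x∈ [])))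
    ; none     = inj₂ (cons (+ 1) x∈ (cons (+ 2) x∈ (cons (- + 3) x∈ [])))
    ; large    = inj₂ (inj₁ (cons (- + 4) y∈ (cons (- + 2) x∈ (cons (- + 3) x∈ []))))
    }

  oddPart-1-2 : OddPart 1 2
  oddPart-1-2 = record { OddPart oddPart-0-3 ; finishes = finishes₁ 0 2 (6 ∷ 7 ∷ []) refl 4 }

  oddPart-2-1 : OddPart 2 1
  oddPart-2-1 = record
    { base     = gap 8
    ; triples  = (1 , 6 , 2) ∷ (2 , 4 , 1) ∷ (3 , 7 , 3) ∷ []
    ; uses     = select-↭ (8 ∷ 2 ∷ 6 ∷ 1 ∷ 3 ∷ 2 ∷ 2 ∷ 1 ∷ 0 ∷ []) _
    ; finishes = finishes₂ 0 3 (7 ∷ []) refl 4 6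
    ; small    = inj₂ (cons (+ 1) x∈ (cons (- + 2) x∈ (cons (+ 3) x∈ [])))
    ; none     = inj₂ (cons (+ 1) x∈ (cons (+ 2) x∈ (cons (- + 3) x∈ [])))
    ; large    = inj₂ (inj₁ (cons (- + 1) x∈ (cons (+ 2) x∈ (cons (- + 10) z∈ []))))
    }

  oddPart-3-0 : OddPart 3 0
  oddPart-3-0 = record
    { base     = gap 8
    ; triples  = (1 , 4 , 1) ∷ (2 , 7 , 3) ∷ (3 , 6 , 2) ∷ []
    ; uses     = select-↭ (5 ∷ 7 ∷ 4 ∷ 5 ∷ 2 ∷ 1 ∷ 2 ∷ 1 ∷ 0 ∷ []) _
    ; finishes = finishes₃ 0 4 [] refl 4 6 7
    ; small    = inj₂ (cons (+ 1) x∈ (cons (- + 2) x∈ (cons (+ 3) x∈ [])))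
    ; none     = inj₂ (cons (+ 1) x∈ (cons (+ 2) x∈ (cons (- + 3) x∈ [])))
    ; large    = inj₂ (inj₁ (cons (- + 4) y∈ (cons (- + 2) x∈ (cons (- + 3) x∈ []))))
    }

few-or-many : ∀ b a → b + a ≤ 3 ⊎ ∃ λ n → b + a ≡ 4 + n
few-or-many b a with 4 ℕ.≤? b + a
... | yes le with n , eq ← ℕ.m≤n⇒∃[o]m+o≡n le = inj₂ (n , sym eq)
... | no  ≰4 = inj₁ (ℕ.≤-pred (ℕ.≰⇒> ≰4))

oddPart : ∀ b a → 1 ≤ b + a → OddPart b a
oddPart b a 1≤ with few-or-many b a
... | inj₂ (n , eq) = skolem-oddPart b a eq (skolem n)
oddPart 0 0 () | inj₁ _
oddPart 0 1 _ | inj₁ _ = oddPart-0-1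
oddPart 1 0 _ | inj₁ _ = oddPart-1-0
oddPart 0 2 _ | inj₁ _ = oddPart-0-2
oddPart 1 1 _ | inj₁ _ = oddPart-1-1
oddPart 2 0 _ | inj₁ _ = oddPart-2-0
oddPart 0 3 _ | inj₁ _ = oddPart-0-3
oddPart 1 2 _ | inj₁ _ = oddPart-1-2
oddPart 2 1 _ | inj₁ _ = oddPart-2-1
oddPart 3 0 _ | inj₁ _ = oddPart-3-0
oddPart 0 (suc (suc (suc (suc _)))) _ | inj₁ (s≤s (s≤s (s≤s ())))
oddPart 1 (suc (suc (suc _))) _ | inj₁ (s≤s (s≤s (s≤s ())))
oddPart 2 (suc (suc _)) _ | inj₁ (s≤s (s≤s (s≤s ())))
oddPart 3 (suc _) _ | inj₁ (s≤s (s≤s (s≤s ())))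
oddPart (suc (suc (suc (suc _)))) _ _ | inj₁ (s≤s (s≤s (s≤s ())))

core-solution : ∀ b a {es} → All EvenSize es → replicate b 5 ++ replicate a 3 ++ es ≢ [] →
  Solution (replicate b 5 ++ replicate a 3 ++ es)
core-solution zero    zero    ees ≢[] = even-solution ≢[] ees
core-solution zero    (suc a) ees _   = odd-solution (oddPart zero (suc a) (s≤s z≤n)) ees
core-solution (suc b) a {es}  ees _   =
  subst Solution (++-assoc (replicate (suc b) 5) (replicate a 3) es)
    (odd-solution (oddPart (suc b) a (s≤s z≤n)) ees)

-- Reduction to the sizes 3, 4, 5 and 6

record Reduced (ns : List ℕ) : Set where
  field
    b a    : ℕ
    es     : List ℕ
    sizes  : All EvenSize es
    cores  : List ℕ
    grown  : Pointwise (λ c n → ∃ λ k → n ≡ k * 4 + c) cores ns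
    order  : replicate b 5 ++ replicate a 3 ++ es ↭ cores

data Core : ℕ → Set where
  three : ∀ k → Core (k * 4 + 3)
  five  : ∀ k → Core (k * 4 + 5)
  even  : ∀ k {e} → EvenSize e → Core (k * 4 + e)

core : ∀ m → Core (3 + m)
core 0 = three 0
core 1 = even 0 (inj₁ refl)
core 2 = five 0
core 3 = even 0 (inj₂ refl)
core (suc (suc (suc (suc m)))) with 3 + m | core m
... | _ | three k  = three (suc k)
... | _ | five k   = five (suc k)
... | _ | even k e = even (suc k) e

reduce : ∀ {ns} → All (3 ≤_) ns → Reduced ns
reduce [] = record { b = 0 ; a = 0 ; es = [] ; sizes = [] ; cores = [] ; grown = [] ; order = ↭-refl }
reduce (le ∷ les) with m , refl ← ℕ.m≤n⇒∃[o]m+o≡n le = cons-core (core m) (reduce les)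
  where
  cons-core : ∀ {n ns} → Core n → Reduced ns → Reduced (n ∷ ns)
  cons-core (three k) r = record
    { b = b ; a = suc a ; es = es ; sizes = sizes ; cores = 3 ∷ cores ; grown = (k , refl) ∷ grown
    ; order = ↭-trans (shift 3 (replicate b 5) _) (prep 3 order) }
    where open Reduced r
  cons-core (five k) r = record
    { b = suc b ; a = a ; es = es ; sizes = sizes ; cores = 5 ∷ cores ; grown = (k , refl) ∷ grown
    ; order = prep 5 order }
    where open Reduced r
  cons-core (even k {e} size) r = record
    { b = b ; a = a ; es = e ∷ es ; sizes = size ∷ sizes ; cores = e ∷ cores ; grown = (k , refl) ∷ grown
    ; order = ↭-trans (++⁺ˡ (replicate b 5) (shift e (replicate a 3) es))
        (↭-trans (shift e (replicate b 5) _) (prep e order)) }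
    where open Reduced r

grow : ∀ {V n sp} k → Solvable V ((n , 0) ∷ sp) → Solvable V ((k * 4 + n , 0) ∷ sp)
grow zero    s = s
grow (suc k) s = grow-four (grow k s)

-- Only the first star of a specification can be enlarged; finished ones move to `done`.
grow-all : ∀ {V cs ns} done → Pointwise (λ c n → ∃ λ k → n ≡ k * 4 + c) cs ns →
  Solvable V (zeros cs ++ done) → Solvable V (zeros ns ++ done)
grow-all done [] s = s
grow-all done (_∷_ {y = n} (k , refl) gs) s =
  resolve (shift (n , 0) _ done)
    (grow-all ((n , 0) ∷ done) gs (resolve (↭-sym (shift (n , 0) _ done)) (grow k s)))

solution : ∀ {ns} → ns ≢ [] → All (3 ≤_) ns → Solution ns
solution {[]}     ns≢[] _   = contradiction refl ns≢[]
solution {n ∷ ns} _     les = finish (core-solution b a sizes cores≢[])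
  where
  open Reduced (reduce les)
  count : length (replicate b 5 ++ replicate a 3 ++ es) ≡ suc (length ns)
  count = ≡.trans (↭-length order) (Pointwise-length grown)
  cores≢[] : replicate b 5 ++ replicate a 3 ++ es ≢ []
  cores≢[] eq with () ← ≡.trans (sym count) (cong length eq)
  finish : Solution (replicate b 5 ++ replicate a 3 ++ es) → Solution (n ∷ ns)
  finish (V , s , zero-sum) = V ,
    subst (Solvable V) (++-identityʳ (zeros (n ∷ ns)))
      (grow-all [] grown (subst (Solvable V) (sym (++-identityʳ (zeros cores)))
        (resolve (map⁺ (_, 0) order) s))) ,
    λ 3≤ → zero-sum (ℕ.≤-trans 3≤ (ℕ.≤-reflexive (sym count)))

-- From signed blocks to labelings of graphs

LabelledGraph : Set
LabelledGraph = List ((ℕ × ℕ) × ℤ)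

edges : LabelledGraph → Graph
edges = map proj₁

value : ∀ lg → Edge (edges lg) → ℤ
value ((_ , z) ∷ lg) fzero     = z
value (_ ∷ lg)       (fsuc e) = value lg e

forward : ℤ → Bool
forward (+ _)    = true
forward -[1+ _ ] = false

signedBy : Bool → ℕ → ℤ
signedBy true  n = + n
signedBy false n = - + n

labelled : (G : Graph) → Orientation G → (Edge G → ℕ) → LabelledGraph
labelled []      o φ = []
labelled (e ∷ G) o φ = (e , signedBy (o fzero) (φ fzero)) ∷ labelled G (o ∘ fsuc) (φ ∘ fsuc)

labelled-value : ∀ lg → labelled (edges lg) (forward ∘ value lg) (∣_∣ ∘ value lg) ≡ lg
labelled-value []                        = refl
labelled-value ((e , + n)      ∷ lg) = cong ((e , + n) ∷_) (labelled-value lg)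
labelled-value ((e , -[1+ n ]) ∷ lg) = cong ((e , -[1+ n ]) ∷_) (labelled-value lg)

labelled-edges : ∀ G o φ → edges (labelled G o φ) ≡ G
labelled-edges []      o φ = refl
labelled-edges (e ∷ G) o φ = cong (e ∷_) (labelled-edges G (o ∘ fsuc) (φ ∘ fsuc))

labelsOf : LabelledGraph → List ℕ
labelsOf = map (∣_∣ ∘ proj₂)

labelled-labels : ∀ G o φ → labelsOf (labelled G o φ) ≡ tabulate φ
labelled-labels []      o φ = refl
labelled-labels (e ∷ G) o φ = cong₂ _∷_ (abs (o fzero)) (labelled-labels G (o ∘ fsuc) (φ ∘ fsuc))
  where
  abs : ∀ b → ∣ signedBy b (φ fzero) ∣ ≡ φ fzero
  abs true  = refl
  abs false = ℤ.∣-i∣≡∣i∣ (+ φ fzero)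

-- An edge (a , b) with signed label z carries z into b and out of a.
flow : ℕ → (ℕ × ℕ) × ℤ → ℤ
flow u ((a , b) , z) = (if b ≡ᵇ u then z else + 0) ℤ.+ (if a ≡ᵇ u then - z else + 0)

excess : LabelledGraph → ℕ → ℤ
excess lg u = total (map (flow u) lg)

vertexSum-excess : ∀ G o φ u → vertexSum G o φ u ≡ excess (labelled G o φ) u
vertexSum-excess []            o φ u = refl
vertexSum-excess ((a , b) ∷ G) o φ u = cong₂ ℤ._+_ (term (o fzero) (b ≡ᵇ u) (a ≡ᵇ u) refl refl)
  (vertexSum-excess G (o ∘ fsuc) (φ ∘ fsuc) u)
  where
  term : ∀ d x y → (b ≡ᵇ u) ≡ x → (a ≡ᵇ u) ≡ y →
    (if (if d then b else a) ≡ᵇ u then + φ fzero else + 0) ℤ.+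
    (if (if d then a else b) ≡ᵇ u then - + φ fzero else + 0)
    ≡ (if x then signedBy d (φ fzero) else + 0) ℤ.+ (if y then - signedBy d (φ fzero) else + 0)
  term true  x y refl refl = refl
  term false x y refl refl = ≡.trans
    (cong (λ i → (if a ≡ᵇ u then i else + 0) ℤ.+ (if b ≡ᵇ u then - + φ fzero else + 0))
      (sym (ℤ.neg-involutive (+ φ fzero))))
    (ℤ.+-comm (if a ≡ᵇ u then - - + φ fzero else + 0) (if b ≡ᵇ u then - + φ fzero else + 0))

degree-++ : ∀ G H u → degree (G ++ H) u ≡ degree G u + degree H u
degree-++ []            H u = refl
degree-++ ((a , b) ∷ G) H u =
  ≡.trans (cong (_+_ (ind (a ≡ᵇ u) + ind (b ≡ᵇ u))) (degree-++ G H u))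
    (sym (+-assoc (ind (a ≡ᵇ u) + ind (b ≡ᵇ u)) (degree G u) (degree H u)))

excess-++ : ∀ lg lg′ u → excess (lg ++ lg′) u ≡ excess lg u ℤ.+ excess lg′ u
excess-++ lg lg′ u = ≡.trans (cong total (map-++ (flow u) lg lg′)) (total-++ (map (flow u) lg) (map (flow u) lg′))

≡ᵇ-refl : ∀ n → (n ≡ᵇ n) ≡ true
≡ᵇ-refl zero    = refl
≡ᵇ-refl (suc n) = ≡ᵇ-refl n

≢⇒≡ᵇ : ∀ {m n} → m ≢ n → (m ≡ᵇ n) ≡ false
≢⇒≡ᵇ {zero}  {zero}  m≢n = contradiction refl m≢n
≢⇒≡ᵇ {zero}  {suc n} m≢n = refl
≢⇒≡ᵇ {suc m} {zero}  m≢n = refl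
≢⇒≡ᵇ {suc m} {suc n} m≢n = ≢⇒≡ᵇ (m≢n ∘ cong suc)

Absent : ℕ → LabelledGraph → Set
Absent u = All λ { ((a , b) , _) → a ≢ u × b ≢ u }

absent-excess : ∀ {u} lg → Absent u lg → excess lg u ≡ + 0
absent-excess [] [] = refl
absent-excess (_ ∷ lg) ((a≢ , b≢) ∷ abs) rewrite ≢⇒≡ᵇ a≢ | ≢⇒≡ᵇ b≢ | absent-excess lg abs = refl

absent-degree : ∀ {u} lg → Absent u lg → degree (edges lg) u ≡ 0
absent-degree [] [] = refl
absent-degree (_ ∷ lg) ((a≢ , b≢) ∷ abs) rewrite ≢⇒≡ᵇ a≢ | ≢⇒≡ᵇ b≢ = absent-degree lg abs

-- Leaf edges are written from `c` outwards. The negation makes every entry of a block, like the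
-- head, flow into `c`.
leaves : ℕ → ℕ → List ℤ → LabelledGraph
leaves c k []      = []
leaves c k (z ∷ t) = ((c , c + suc k) , - z) ∷ leaves c (suc k) t

flake : ℕ → List Block → LabelledGraph
flake c []             = []
flake c ((h , t) ∷ bs) = ((0 , c) , h) ∷ leaves c 0 t ++ flake (c + suc (length t)) bs

sizes : List Block → List ℕ
sizes = map (length ∘ entries)

leaf : ℕ → ℕ → ℕ × ℕ
leaf c k = c , c + suc k

leaves-edges : ∀ c k g t → (∀ i → g i ≡ k + i) →
  edges (leaves c k t) ≡ map (leaf c) (applyUpTo g (length t))
leaves-edges c k g []      eq = refl
leaves-edges c k g (z ∷ t) eq = cong₂ _∷_
  (cong (leaf c) (≡.trans (sym (ℕ.+-identityʳ k)) (sym (eq 0))))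
  (leaves-edges c (suc k) (g ∘ suc) t (λ i → ≡.trans (eq (suc i)) (ℕ.+-suc k i)))

flake-edges : ∀ c bs → edges (flake c bs) ≡ snowflakeFrom c (sizes bs)
flake-edges c []             = refl
flake-edges c ((h , t) ∷ bs) = cong ((0 , c) ∷_)
  (≡.trans (map-++ proj₁ (leaves c 0 t) (flake (c + suc (length t)) bs))
    (cong₂ _++_ (leaves-edges c 0 (λ i → i) t (λ _ → refl)) (flake-edges (c + suc (length t)) bs)))

uncons-leaves : ∀ c k g n {rest} lg → (∀ i → g i ≡ k + i) →
  edges lg ≡ map (leaf c) (applyUpTo g n) ++ rest →
  ∃₂ λ t lg′ → lg ≡ leaves c k t ++ lg′ × length t ≡ n × edges lg′ ≡ rest
uncons-leaves c k g zero    lg             eq es = [] , lg , refl , refl , es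
uncons-leaves c k g (suc n) ((e , z) ∷ lg) eq es
  with refl , es′ ← ∷-injective es
  with t , lg′ , refl , refl , es″ ← uncons-leaves c (suc k) (g ∘ suc) n lg
                                       (λ i → ≡.trans (eq (suc i)) (ℕ.+-suc k i)) es′
  = - z ∷ t , lg′ ,
    cong (_∷ leaves c (suc k) t ++ lg′) (cong₂ _,_ (cong (leaf c) (≡.trans (eq 0) (ℕ.+-identityʳ k))) (sym (ℤ.neg-involutive z))) ,
    refl , es″

-- This converse direction serves the nonexistence half: an arbitrary labeling must be read as
-- blocks before the parity argument applies.
unflake : ∀ c ns lg → All (3 ≤_) ns → edges lg ≡ snowflakeFrom c ns →
  ∃ λ bs → lg ≡ flake c bs × sizes bs ≡ ns
unflake c []           []             _          es = [] , refl , refl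
unflake c (suc n ∷ ns) ((e , z) ∷ lg) (_ ∷ les)  es
  with refl , es′ ← ∷-injective es
  with t , lg′ , refl , refl , es″ ← uncons-leaves c 0 (λ i → i) n lg (λ _ → refl) es′
  with bs , refl , refl ← unflake (c + suc n) ns lg′ les es″
  = (z , t) ∷ bs , refl , refl

leaves-labels : ∀ c k t → labelsOf (leaves c k t) ≡ map ∣_∣ t
leaves-labels c k []      = refl
leaves-labels c k (z ∷ t) = cong₂ _∷_ (ℤ.∣-i∣≡∣i∣ z) (leaves-labels c (suc k) t)

flake-labels : ∀ c bs → labelsOf (flake c bs) ≡ concatMap blockLabels bs
flake-labels c []             = refl
flake-labels c ((h , t) ∷ bs) = cong (∣ h ∣ ∷_)
  (≡.trans (map-++ (∣_∣ ∘ proj₂) (leaves c 0 t) (flake (c + suc (length t)) bs))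
    (cong₂ _++_ (leaves-labels c 0 t) (flake-labels (c + suc (length t)) bs)))

leaves-absent : ∀ {u} c k t → c ≢ u → (∀ i → k ≤ i → i < k + length t → c + suc i ≢ u) → Absent u (leaves c k t)
leaves-absent c k []      c≢u away = []
leaves-absent c k (z ∷ t) c≢u away =
  (c≢u , away k ℕ.≤-refl (ℕ.m<m+n k (s≤s z≤n))) ∷
  leaves-absent c (suc k) t c≢u (λ i k<i i< →
    away i (ℕ.<⇒≤ k<i) (ℕ.≤-trans i< (ℕ.≤-reflexive (sym (ℕ.+-suc k (length t))))))

flake-absent : ∀ {u} c bs → 1 ≤ u → u < c → Absent u (flake c bs)
flake-absent c []             1≤u u<c = []
flake-absent c ((h , t) ∷ bs) 1≤u u<c =
  (ℕ.<⇒≢ 1≤u , ℕ.>⇒≢ u<c) ∷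
  All.++⁺ (leaves-absent c 0 t (ℕ.>⇒≢ u<c) (λ i _ _ → ℕ.>⇒≢ (ℕ.≤-trans u<c (ℕ.m≤m+n c (suc i)))))
    (flake-absent (c + suc (length t)) bs 1≤u (ℕ.≤-trans u<c (ℕ.m≤m+n c _)))

leaves-center : ∀ c k t → excess (leaves c k t) c ≡ total t
leaves-center c k []      = refl
leaves-center c k (z ∷ t)
  rewrite ≡ᵇ-refl c | ≢⇒≡ᵇ {c + suc k} {c} (ℕ.>⇒≢ (ℕ.m<m+n c (s≤s z≤n))) | leaves-center c (suc k) t
  = cong (ℤ._+ total t) (≡.trans (ℤ.+-identityˡ (- - z)) (ℤ.neg-involutive z))

flake-center : ∀ c h t bs → 1 ≤ c → excess (flake c ((h , t) ∷ bs)) c ≡ total (h ∷ t)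
flake-center c h t bs 1≤c
  rewrite ≡ᵇ-refl c | ≢⇒≡ᵇ (ℕ.<⇒≢ 1≤c)
        | excess-++ (leaves c 0 t) (flake (c + suc (length t)) bs) c
        | leaves-center c 0 t
        | absent-excess (flake (c + suc (length t)) bs) (flake-absent _ bs 1≤c (ℕ.m<m+n c (s≤s z≤n)))
  = cong₂ ℤ._+_ (ℤ.+-identityʳ h) (ℤ.+-identityʳ (total t))

star-absent : ∀ {u} c h t → 1 ≤ u → c + suc (length t) ≤ u → Absent u (((0 , c) , h) ∷ leaves c 0 t)
star-absent c h t 1≤u c≤u =
  (ℕ.<⇒≢ 1≤u , ℕ.<⇒≢ c<u) ∷
  leaves-absent c 0 t (ℕ.<⇒≢ c<u) (λ i _ i< → ℕ.<⇒≢ (ℕ.≤-trans (ℕ.+-monoʳ-< c (s≤s i<)) c≤u))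
  where
  c<u : c < _
  c<u = ℕ.≤-trans (ℕ.m<m+n c (s≤s z≤n)) c≤u

leaves-degree : ∀ {u} c k t → c ≢ u → degree (edges (leaves c k t)) u ≤ 1
leaves-degree c k []      c≢u = z≤n
leaves-degree {u} c k (z ∷ t) c≢u with c + suc k ℕ.≟ u
... | no  ≢u rewrite ≢⇒≡ᵇ c≢u | ≢⇒≡ᵇ ≢u = leaves-degree c (suc k) t c≢u
... | yes refl rewrite ≢⇒≡ᵇ c≢u | ≡ᵇ-refl (c + suc k)
  | absent-degree (leaves c (suc k) t) (leaves-absent c (suc k) t c≢u
      (λ i k<i _ → ℕ.>⇒≢ (ℕ.+-monoʳ-< c (s≤s k<i)))) = ℕ.≤-refl

-- A nonzero vertex is the center of a star, a leaf of degree 1, or absent. Its position relative to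
-- `c` and to the next center tells which.
flake-balanced : ∀ c bs {u} → 1 ≤ c → 1 ≤ u → All (λ b → total (entries b) ≡ + 0) bs →
  degree (edges (flake c bs)) u ≤ 1 ⊎ excess (flake c bs) u ≡ + 0
flake-balanced c []             _   _   _            = inj₂ refl
flake-balanced c ((h , t) ∷ bs) {u} 1≤c 1≤u (zero-sum ∷ zs) = position (ℕ.<-cmp u c) ((c + suc (length t)) ℕ.≤? u)
  where
  rest : LabelledGraph
  rest = flake (c + suc (length t)) bs
  whole : LabelledGraph
  whole = flake c ((h , t) ∷ bs)
  star′ : LabelledGraph
  star′ = ((0 , c) , h) ∷ leaves c 0 t
  degree-split : degree (edges whole) u ≡ degree (edges star′) u + degree (edges rest) u
  degree-split = ≡.trans (cong (λ G → degree G u) (map-++ proj₁ star′ rest)) (degree-++ (edges star′) (edges rest) u)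
  position : Tri (u < c) (u ≡ c) (c < u) → Dec (c + suc (length t) ≤ u) →
    degree (edges whole) u ≤ 1 ⊎ excess whole u ≡ + 0
  position (tri< u<c _ _) _ = inj₂ (absent-excess whole (flake-absent c ((h , t) ∷ bs) 1≤u u<c))
  position (tri≈ _ refl _) _ = inj₂ (≡.trans (flake-center c h t bs 1≤c) zero-sum)
  position (tri> _ _ c<u) (no u≱) = inj₁ (ℕ.≤-trans (ℕ.≤-reflexive single) (leaves-degree c 0 t (ℕ.<⇒≢ c<u)))
    where
    single : degree (edges whole) u ≡ degree (edges (leaves c 0 t)) u
    single rewrite degree-split | absent-degree rest (flake-absent _ bs 1≤u (ℕ.≰⇒> u≱))
                 | ≢⇒≡ᵇ (ℕ.<⇒≢ 1≤u) | ≢⇒≡ᵇ (ℕ.<⇒≢ c<u) = ℕ.+-identityʳ _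
  position (tri> _ _ c<u) (yes le) with flake-balanced (c + suc (length t)) bs (ℕ.≤-trans 1≤c (ℕ.m≤m+n c _)) 1≤u zs
  ... | inj₁ deg≤1 = inj₁ (ℕ.≤-trans (ℕ.≤-reflexive (≡.trans degree-split
          (cong (_+ degree (edges rest) u) (absent-degree star′ (star-absent c h t 1≤u le))))) deg≤1)
  ... | inj₂ balanced = inj₂ (≡.trans (excess-++ star′ rest u)
          (≡.trans (cong (ℤ._+ excess rest u) (absent-excess star′ (star-absent c h t 1≤u le)))
            (≡.trans (ℤ.+-identityˡ _) balanced)))

flake-excess-0 : ∀ c bs → 1 ≤ c → excess (flake c bs) 0 ≡ - total (map proj₁ bs)
flake-excess-0 c [] _ = refl
flake-excess-0 c ((h , t) ∷ bs) 1≤c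
  rewrite ≢⇒≡ᵇ (ℕ.>⇒≢ 1≤c)
        | excess-++ (leaves c 0 t) (flake (c + suc (length t)) bs) 0
        | absent-excess (leaves c 0 t) (leaves-absent c 0 t (ℕ.>⇒≢ 1≤c)
            (λ i _ _ → ℕ.>⇒≢ (ℕ.≤-trans 1≤c (ℕ.m≤m+n c _))))
        | flake-excess-0 (c + suc (length t)) bs (ℕ.≤-trans 1≤c (ℕ.m≤m+n c _))
  = ≡.trans (cong₂ ℤ._+_ (ℤ.+-identityˡ (- h)) (ℤ.+-identityˡ _)) (sym (ℤ.neg-distrib-+ h _))

-- This is why the head sum has to vanish only for three or more stars.
flake-degree-0 : ∀ c bs → 1 ≤ c → degree (edges (flake c bs)) 0 ≡ length bs
flake-degree-0 c [] _ = refl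
flake-degree-0 c ((h , t) ∷ bs) 1≤c
  rewrite ≢⇒≡ᵇ (ℕ.>⇒≢ 1≤c)
        | map-++ proj₁ (leaves c 0 t) (flake (c + suc (length t)) bs)
        | degree-++ (edges (leaves c 0 t)) (edges (flake (c + suc (length t)) bs)) 0
        | absent-degree (leaves c 0 t) (leaves-absent c 0 t (ℕ.>⇒≢ 1≤c)
            (λ i _ _ → ℕ.>⇒≢ (ℕ.≤-trans 1≤c (ℕ.m≤m+n c _))))
  = cong suc (flake-degree-0 (c + suc (length t)) bs (ℕ.≤-trans 1≤c (ℕ.m≤m+n c _)))

tabulate-injective : ∀ {n} (f : Fin n → ℕ) → Unique (tabulate f) → ∀ {i j} → f i ≡ f j → i ≡ j
tabulate-injective f (_ ∷ _)  {fzero}   {fzero}   eq = refl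
tabulate-injective f (f≢ ∷ _) {fzero}   {fsuc j} eq = contradiction eq (All.tabulate⁻ f≢ j)
tabulate-injective f (f≢ ∷ _) {fsuc i} {fzero}   eq = contradiction (sym eq) (All.tabulate⁻ f≢ i)
tabulate-injective f (_ ∷ us) {fsuc i} {fsuc j} eq = cong fsuc (tabulate-injective (f ∘ fsuc) us eq)

descend-unique : ∀ n → Unique (descend n)
descend-unique zero    = []
descend-unique (suc n) = All.map (λ le → ℕ.>⇒≢ (s≤s le)) (descend-≤ n) ∷ descend-unique n

used-unique : ∀ st → Unique (used st)
used-unique (full n) = descend-unique n
used-unique (gap n)  = All.map (λ le → ℕ.>⇒≢ (s≤s (ℕ.m≤n⇒m≤1+n le))) (descend-≤ n) ∷ descend-unique n

∈-descend⁻ : ∀ {x} n → x ∈ descend n → 1 ≤ x × x ≤ n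
∈-descend⁻ (suc n) (here refl) = s≤s z≤n , ℕ.≤-refl
∈-descend⁻ (suc n) (there x∈) with 1≤x , x≤n ← ∈-descend⁻ n x∈ = 1≤x , ℕ.m≤n⇒m≤1+n x≤n

∈-descend⁺ : ∀ {x} n → 1 ≤ x → x ≤ n → x ∈ descend n
∈-descend⁺ zero    (s≤s _) ()
∈-descend⁺ (suc n) 1≤x x≤n with ℕ.m≤n⇒m<n∨m≡n x≤n
... | inj₁ (s≤s x≤n′) = there (∈-descend⁺ n 1≤x x≤n′)
... | inj₂ refl       = here refl

isLabeling : ∀ G φ {L} st → tabulate φ ↭ used st →
  (∀ {x} → x ∈ used st → L x) → (∀ {x} → L x → x ∈ used st) → IsLabeling G L φ
isLabeling G φ st p sound complete =
  tabulate-injective φ (Permutationₛ.Unique-resp-↭ (≡.setoid ℕ) (↭⇒↭ₛ (↭-sym p)) (used-unique st)) ,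
  (λ e → sound (∈-resp-↭ p (∈-tabulate⁺ e))) ,
  λ x Lx → let e , eq = ∈-tabulate⁻ (∈-resp-↭ (↭-sym p) (complete Lx)) in e , sym eq

fits-sizes : ∀ {ns bs} → Pointwise Fits (zeros ns) bs → sizes bs ≡ ns
fits-sizes {[]}     []       = refl
fits-sizes {n ∷ ns} (f ∷ ps) = cong₂ _∷_ (proj₁ f) (fits-sizes ps)

fits-totals : ∀ {ns bs} → Pointwise Fits (zeros ns) bs → All (λ b → total (entries b) ≡ + 0) bs
fits-totals {[]}     []       = []
fits-totals {n ∷ ns} (f ∷ ps) = ℤ.∣i∣≡0⇒i≡0 (proj₂ f) ∷ fits-totals ps

admits : ∀ ns {V L} st → Conf (used st) V (zeros ns) → (3 ≤ length ns → V ≡ + 0) →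
  (∀ {x} → x ∈ used st → L x) → (∀ {x} → L x → x ∈ used st) → AdmitsLabeling (snowflake ns) L
admits ns {V} {L} st (conf bs fits heads labels) zero-sum sound complete =
  subst (λ G → AdmitsLabeling G L) (≡.trans (flake-edges 1 bs) (cong snowflake (fits-sizes fits)))
    (forward ∘ value lg , ∣_∣ ∘ value lg ,
     isLabeling (edges lg) _ st (↭-trans (↭-reflexive values) labels) sound complete , balanced)
  where
  lg : LabelledGraph
  lg = flake 1 bs
  values : tabulate (∣_∣ ∘ value lg) ≡ concatMap blockLabels bs
  values = ≡.trans (sym (labelled-labels (edges lg) (forward ∘ value lg) (∣_∣ ∘ value lg)))
    (≡.trans (cong labelsOf (labelled-value lg)) (flake-labels 1 bs))
  sum-≡ : ∀ u → vertexSum (edges lg) (forward ∘ value lg) (∣_∣ ∘ value lg) u ≡ excess lg u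
  sum-≡ u = ≡.trans (vertexSum-excess (edges lg) _ _ u) (cong (λ l → excess l u) (labelled-value lg))
  count : length bs ≡ length ns
  count = ≡.trans (sym (length-map (length ∘ entries) bs)) (cong length (fits-sizes fits))
  balanced : Balanced (edges lg) (forward ∘ value lg) (∣_∣ ∘ value lg)
  balanced zero 3≤ = ≡.trans (sum-≡ 0) (≡.trans (flake-excess-0 1 bs ℕ.≤-refl)
    (cong -_ (≡.trans heads (zero-sum (ℕ.≤-trans 3≤
      (ℕ.≤-reflexive (≡.trans (flake-degree-0 1 bs ℕ.≤-refl) count)))))))
  balanced (suc u) 3≤ with flake-balanced 1 bs {suc u} ℕ.≤-refl (s≤s z≤n) (fits-totals fits)
  ... | inj₁ ≤1   = contradiction (ℕ.≤-trans 3≤ ≤1) λ { (s≤s ()) }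
  ... | inj₂ eq   = ≡.trans (sum-≡ (suc u)) eq

-- Parity of the label sums

Even : ℕ → Set
Even n = ∃ λ k → n ≡ k + k

even-+ : ∀ {m n} → Even m → Even n → Even (m + n)
even-+ (j , refl) (k , refl) = j + k , shuffle j k
  where
  shuffle : ∀ j k → (j + j) + (k + k) ≡ (j + k) + (j + k)
  shuffle = ℕRing.solve-∀

∣i∣≡i+j+j : ∀ i → ∃ λ j → + ∣ i ∣ ≡ i ℤ.+ (j ℤ.+ j)
∣i∣≡i+j+j (+ n)    = + 0 , sym (ℤ.+-identityʳ (+ n))
∣i∣≡i+j+j -[1+ n ] = + suc n , cancelled (+ suc n)
  where
  cancelled : ∀ x → x ≡ - x ℤ.+ (x ℤ.+ x)
  cancelled = ℤRing.solve-∀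

abs-parity : ∀ xs → ∃ λ j → + sum (map ∣_∣ xs) ≡ total xs ℤ.+ (j ℤ.+ j)
abs-parity []       = + 0 , refl
abs-parity (x ∷ xs) with j , eq ← abs-parity xs | i , eq′ ← ∣i∣≡i+j+j x = i ℤ.+ j ,
  ≡.trans (cong₂ ℤ._+_ eq′ eq) (shuffle x i (total xs) j)
  where
  shuffle : ∀ x i t j → (x ℤ.+ (i ℤ.+ i)) ℤ.+ (t ℤ.+ (j ℤ.+ j)) ≡ (x ℤ.+ t) ℤ.+ ((i ℤ.+ j) ℤ.+ (i ℤ.+ j))
  shuffle = ℤRing.solve-∀

zero-sum⇒even : ∀ xs → total xs ≡ + 0 → Even (sum (map ∣_∣ xs))
zero-sum⇒even xs zs with abs-parity xs
... | + k      , eq = k , ℤ.+-injective (≡.trans eq (cong (ℤ._+ (+ k ℤ.+ + k)) zs))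
-- The sum of absolute values is a natural number, so it is not twice a negative one.
... | -[1+ k ] , eq with () ← ≡.trans eq (cong (ℤ._+ (-[1+ k ] ℤ.+ -[1+ k ])) zs)

blocks-even : ∀ bs → All (λ b → total (entries b) ≡ + 0) bs → Even (sum (concatMap blockLabels bs))
blocks-even []       []       = 0 , refl
blocks-even (b ∷ bs) (z ∷ zs) = subst Even (sym (sum-++ (blockLabels b) (concatMap blockLabels bs)))
  (even-+ (zero-sum⇒even (entries b) z) (blocks-even bs zs))

conf-even : ∀ {L V} ns → Conf L V (zeros ns) → Even (sum L)
conf-even ns (conf bs fits _ labels) = subst Even (sum-↭ labels) (blocks-even bs (fits-totals fits))

-- A star of size at least 3 gives its center degree at least 3, so balance is required there.
-- Vertices from the next center on do not meet the current star, so the hypothesis passes to the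
-- remaining stars.
centers-balanced : ∀ c bs → 1 ≤ c → All (3 ≤_) (sizes bs) →
  (∀ u → 1 ≤ u → 3 ≤ degree (edges (flake c bs)) u → excess (flake c bs) u ≡ + 0) →
  All (λ b → total (entries b) ≡ + 0) bs
centers-balanced c []             _   _          _        = []
centers-balanced c ((h , t) ∷ bs) 1≤c (3≤ ∷ les) balanced =
  ≡.trans (sym (flake-center c h t bs 1≤c)) (balanced c 1≤c center-degree) ∷
  centers-balanced (c + suc (length t)) bs (ℕ.≤-trans 1≤c (ℕ.m≤m+n c _)) les rest-balanced
  where
  rest star′ : LabelledGraph
  rest  = flake (c + suc (length t)) bs
  star′ = ((0 , c) , h) ∷ leaves c 0 t
  degree-split : ∀ u → degree (edges (star′ ++ rest)) u ≡ degree (edges star′) u + degree (edges rest) u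
  degree-split u = ≡.trans (cong (λ G → degree G u) (map-++ proj₁ star′ rest)) (degree-++ (edges star′) (edges rest) u)
  leaves-center-degree : ∀ k t → degree (edges (leaves c k t)) c ≡ length t
  leaves-center-degree k []      = refl
  leaves-center-degree k (z ∷ t)
    rewrite ≡ᵇ-refl c | ≢⇒≡ᵇ {c + suc k} {c} (ℕ.>⇒≢ (ℕ.m<m+n c (s≤s z≤n))) = cong suc (leaves-center-degree (suc k) t)
  star-degree : degree (edges star′) c ≡ suc (length t)
  star-degree rewrite ≢⇒≡ᵇ (ℕ.<⇒≢ 1≤c) | ≡ᵇ-refl c = cong suc (leaves-center-degree 0 t)
  center-degree : 3 ≤ degree (edges (star′ ++ rest)) c
  center-degree rewrite degree-split c | star-degree = ℕ.≤-trans 3≤ (ℕ.m≤m+n _ _)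
  rest-balanced : ∀ u → 1 ≤ u → 3 ≤ degree (edges rest) u → excess rest u ≡ + 0
  rest-balanced u 1≤u 3≤deg with (c + suc (length t)) ℕ.≤? u
  ... | no  u≱ = absent-excess rest (flake-absent _ bs 1≤u (ℕ.≰⇒> u≱))
  ... | yes le = ≡.trans (sym (≡.trans (excess-++ star′ rest u)
          (≡.trans (cong (ℤ._+ excess rest u) (absent-excess star′ (star-absent c h t 1≤u le))) (ℤ.+-identityˡ _))))
        (balanced u 1≤u (ℕ.≤-trans 3≤deg (ℕ.≤-trans (ℕ.m≤n+m _ _) (ℕ.≤-reflexive (sym (degree-split u))))))

labeling-↭ : ∀ G φ → IsLabeling G (LabelsCons (length G)) φ → tabulate φ ↭ descend (length G)
labeling-↭ G φ (injective , sound , complete) =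
  ∼bag⇒↭ (unique∧set⇒bag (tabulate⁺ injective) (descend-unique (length G)) (mk⇔ to from))
  where
  to : ∀ {x} → x ∈ tabulate φ → x ∈ descend (length G)
  to x∈ with e , refl ← ∈-tabulate⁻ x∈ = ∈-descend⁺ _ (proj₁ (sound e)) (proj₂ (sound e))
  from : ∀ {x} → x ∈ descend (length G) → x ∈ tabulate φ
  from {x} x∈ with e , refl ← complete x (∈-descend⁻ _ x∈) = ∈-tabulate⁺ e

conservative⇒even : ∀ ns → All (3 ≤_) ns → Conservative (snowflake ns) →
  Even (sum (descend (length (snowflake ns))))
conservative⇒even ns les (o , φ , labeling , balanced) =
  subst Even (sum-↭ (↭-trans (↭-reflexive (labelled-labels G o φ)) (labeling-↭ G φ labeling)))
    (even-labels (unflake 1 ns (labelled G o φ) les (labelled-edges G o φ)) refl)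
  where
  G : Graph
  G = snowflake ns
  even-labels : (∃ λ bs → labelled G o φ ≡ flake 1 bs × sizes bs ≡ ns) → ∀ {lg} → lg ≡ labelled G o φ →
    Even (sum (labelsOf lg))
  even-labels (bs , eq , sizes≡) refl rewrite eq | flake-labels 1 bs =
    blocks-even bs (centers-balanced 1 bs ℕ.≤-refl (subst (All (3 ≤_)) (sym sizes≡) les)
      λ u 1≤u 3≤deg → ≡.trans (sym (≡.trans (vertexSum-excess G o φ u) (cong (λ l → excess l u) eq)))
        (balanced u (subst (λ H → 3 ≤ degree H u)
          (≡.trans (cong edges (sym eq)) (labelled-edges G o φ)) 3≤deg)))

sum-descend : ∀ r q → ∃ λ k → sum (descend (q * 4 + r)) ≡ (k + k) + sum (descend r)
sum-descend r zero    = 0 , refl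
sum-descend r (suc q) with k , eq ← sum-descend r q = k + ((q * 4 + r) * 2 + 5) ,
  ≡.trans (cong (λ s → 4 + n + (3 + n + (2 + n + (1 + n + s)))) eq) (shuffle k n (sum (descend r)))
  where
  n : ℕ
  n = q * 4 + r
  shuffle : ∀ k n s → 4 + n + (3 + n + (2 + n + (1 + n + ((k + k) + s))))
    ≡ (k + (n * 2 + 5)) + (k + (n * 2 + 5)) + s
  shuffle = ℕRing.solve-∀

sum-descend-% : ∀ M r → M % 4 ≡ r → ∃ λ k → sum (descend M) ≡ (k + k) + sum (descend r)
sum-descend-% M r eq = subst (λ m → ∃ λ k → sum (descend m) ≡ (k + k) + sum (descend r))
  (sym (≡.trans (m≡m%n+[m/n]*n M 4) (≡.trans (cong (_+ M / 4 * 4) eq) (+-comm r (M / 4 * 4)))))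
  (sum-descend r (M / 4))

even-triangle : ∀ M → M % 4 ≡ 0 ⊎ M % 4 ≡ 3 → Even (sum (descend M))
even-triangle M (inj₁ eq) with k , eq′ ← sum-descend-% M 0 eq = subst Even (sym eq′) (even-+ (k , refl) (0 , refl))
even-triangle M (inj₂ eq) with k , eq′ ← sum-descend-% M 3 eq = subst Even (sym eq′) (even-+ (k , refl) (3 , refl))

-- Oddness is stated through the successor because that is the sum of the near-conservative label
-- set, where M + 1 replaces M.
odd-triangle : ∀ M → M % 4 ≡ 1 ⊎ M % 4 ≡ 2 → Even (suc (sum (descend M)))
odd-triangle M (inj₁ eq) with k , eq′ ← sum-descend-% M 1 eq =
  subst Even (≡.trans (ℕ.+-suc (k + k) 1) (cong suc (sym eq′))) (even-+ (k , refl) (1 , refl))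
odd-triangle M (inj₂ eq) with k , eq′ ← sum-descend-% M 2 eq =
  subst Even (≡.trans (ℕ.+-suc (k + k) 3) (cong suc (sym eq′))) (even-+ (k , refl) (2 , refl))

not-both-even : ∀ {n} → Even n → ¬ Even (suc n)
not-both-even (k , refl) (j , eq) = even≢odd j k (sym eq)

descend-length : ∀ n → length (descend n) ≡ n
descend-length zero    = refl
descend-length (suc n) = cong suc (descend-length n)

used-length : ∀ ns {st V} → Conf (used st) V (zeros ns) → length (snowflake ns) ≡ length (used st)
used-length ns (conf bs fits _ labels) =
  ≡.trans (cong length (sym (≡.trans (flake-edges 1 bs) (cong snowflake (fits-sizes fits)))))
    (≡.trans (length-map proj₁ (flake 1 bs))
      (≡.trans (sym (length-map (∣_∣ ∘ proj₂) (flake 1 bs)))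
        (≡.trans (cong length (flake-labels 1 bs)) (↭-length labels))))

-- Every finished configuration has an even label sum, so the parity of 1 + ... + M decides whether
-- the construction ended in a full or in a gap state; the other case is contradictory.
conclude : ∀ ns {V} → let M = length (snowflake ns) in
  All (3 ≤_) ns → Solvable V (zeros ns) → (3 ≤ length ns → V ≡ + 0) →
  (Even (sum (descend M)) → Conservative (snowflake ns)) ×
  (Even (suc (sum (descend M))) → NearConservative (snowflake ns))
conclude ns les (full n , c) zero-sum =
  (λ _ → admits ns (full n) c zero-sum
    (λ {x} x∈ → subst (λ m → LabelsCons m x) (sym count) (∈-descend⁻ n x∈))
    (λ { (1≤x , x≤M) → ∈-descend⁺ n 1≤x (subst (_ ≤_) count x≤M) })) ,
  (λ odd → contradiction odd (not-both-even (subst (λ m → Even (sum (descend m))) (sym count) (conf-even ns c))))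
  where
  count : length (snowflake ns) ≡ n
  count = ≡.trans (used-length ns {full n} c) (descend-length n)
conclude ns les (gap n , c) zero-sum =
  -- The sum of `used (gap n)` is by computation the successor of the sum of `descend (suc n)`.
  (λ even → contradiction (conf-even ns c)
    (not-both-even (subst (λ m → Even (sum (descend m))) count even))) ,
  (λ odd → (λ conservative → not-both-even (conservative⇒even ns les conservative) odd) ,
    admits ns (gap n) c zero-sum
      (λ { {x} x∈ → subst (λ m → LabelsNear m x) (sym count) (sound x∈) })
      (λ {x} near → complete (subst (λ m → LabelsNear m x) count near)))
  where
  count : length (snowflake ns) ≡ suc n
  count = ≡.trans (used-length ns {gap n} c) (cong suc (descend-length n))
  sound : ∀ {x} → x ∈ used (gap n) → LabelsNear (suc n) x
  sound (here refl) = inj₂ refl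
  sound (there x∈)  = inj₁ (∈-descend⁻ n x∈)
  complete : ∀ {x} → LabelsNear (suc n) x → x ∈ used (gap n)
  complete (inj₁ (1≤x , x≤n)) = there (∈-descend⁺ n 1≤x x≤n)
  complete (inj₂ refl)        = here refl

theorem37 : (ns : List ℕ) → ValidSnowflake ns →
    ((length (snowflake ns) % 4 ≡ 0 ⊎ length (snowflake ns) % 4 ≡ 3) → Conservative (snowflake ns))
    × ((length (snowflake ns) % 4 ≡ 1 ⊎ length (snowflake ns) % 4 ≡ 2) → NearConservative (snowflake ns))
theorem37 ns (ns≢[] , les) with V , s , zero-sum ← solution ns≢[] les =
  (λ r → proj₁ (conclude ns les s zero-sum) (even-triangle (length (snowflake ns)) r)) ,
  (λ r → proj₂ (conclude ns les s zero-sum) (odd-triangle (length (snowflake ns)) r))
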